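{- Let $G$ be a connected graph with $|L_e(G)|\geq 3$ and $w(G)\leq 2|L_e(G)|+1$. Then $\chi(G)\leq 2|L_e(G)|+1$.
   Context: All graphs are finite, simple and undirected. $L_e(G)$ denotes the set of all even integers $m$ such that $G$ contains a cycle of length $m$. $w(G)$ denotes the clique number of $G$ (the number of vertices of a largest clique) and $\chi(G)$ the chromatic number. -}

module Defs where

open import Data.Fin using (Fin; zero; suc; toℕ; finToFun; funToFin)
import Data.Fin.Properties as Fin
open import Data.Fin.Subset using (Subset; _∈_; ∣_∣; ⊥)
open import Data.Fin.Subset.Properties using (_∈?_; anySubset?; ∣p∣≤n; ∉⊥; ∣⊥∣≡0)
open import Data.List using (List; length; filter; upTo)
import Data.List.Membership.Propositional as List
open import Data.List.Membership.Propositional.Properties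
  using (∈-filter⁺; ∈-filter⁻; ∈-upTo⁺)
open import Data.List.Relation.Unary.Unique.Propositional using (Unique)
import Data.List.Relation.Unary.Unique.Propositional.Properties as Unique
open import Data.Nat using (ℕ; zero; suc; _≤_; _<_; s≤s; _≟_; _≤?_)
open import Data.Nat.Divisibility using (_∣_; _∣?_)
open import Data.Nat.Properties using (≮⇒≥; ≤∧≢⇒<; ≤-pred)
open import Data.Product using (∃; ∃-syntax; _×_; _,_; proj₁; proj₂)
open import Data.Sum using (_⊎_; inj₁; inj₂)
open import Function using (id; _∘_)
open import Function.Bundles using (_⇔_; mk⇔)
open import Function.Definitions using (Injective)
open import Level using (0ℓ)
open import Relation.Binary.Construct.Closure.ReflexiveTransitive using (Star)
open import Relation.Binary.Core using (Rel)
import Relation.Binary.Definitions as Binary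
open import Relation.Binary.PropositionalEquality
  using (_≡_; _≢_; _≗_; refl; sym; subst₂)
open import Relation.Nullary using (¬_; Dec; yes; no; contradiction)
open import Relation.Nullary.Decidable using (map′; _×-dec_; _→-dec_; ¬?)
open import Relation.Unary using (Pred; Decidable)

record Graph : Set₁ where
  field
    order    : ℕ
  Vertex : Set
  Vertex = Fin order
  field
    Adj      : Rel Vertex 0ℓ
    adj?     : Binary.Decidable Adj
    symm     : Binary.Symmetric Adj
    loopless : ∀ v → ¬ Adj v v

open Graph public using (order; Vertex)

IsLeast : Pred ℕ 0ℓ → Pred ℕ 0ℓ
IsLeast P k = P k × (∀ j → P j → k ≤ j)

IsGreatest : Pred ℕ 0ℓ → Pred ℕ 0ℓ
IsGreatest P k = P k × (∀ j → P j → j ≤ k)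

HasCardinality : Pred ℕ 0ℓ → Pred ℕ 0ℓ
HasCardinality P k =
  ∃[ xs ] Unique xs × (∀ m → (m List.∈ xs) ⇔ P m) × length xs ≡ k

module _ {P : Pred ℕ 0ℓ} (P? : Decidable P) where

  least : ∀ {k} → P k → ∃ (IsLeast P)
  least {k} pk with search k
    where
    search : ∀ b → ∃ (IsLeast P) ⊎ (∀ j → j < b → ¬ P j)
    search zero = inj₂ λ _ ()
    search (suc b) with search b
    ... | inj₁ found = inj₁ found
    ... | inj₂ none with P? b
    ...   | yes pb = inj₁ (b , pb , λ j pj → ≮⇒≥ λ j<b → none j j<b pj)
    ...   | no ¬pb = inj₂ λ j j<1+b pj →
      none j (≤∧≢⇒< (≤-pred j<1+b) λ { refl → ¬pb pj }) pj
  ... | inj₁ found = found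
  ... | inj₂ none  = k , pk , λ j pj → ≮⇒≥ λ j<k → none j j<k pj

  greatest : ∀ b → P 0 → (∀ j → P j → j ≤ b) → ∃ (IsGreatest P)
  greatest zero    p0 bound = 0 , p0 , bound
  greatest (suc b) p0 bound with P? (suc b)
  ... | yes pb = suc b , pb , bound
  ... | no ¬pb = greatest b p0 λ j pj →
    ≤-pred (≤∧≢⇒< (bound j pj) λ { refl → ¬pb pj })

  cardinality : ∀ b → (∀ j → P j → j ≤ b) → ∃ (HasCardinality P)
  cardinality b bound =
    length xs , xs , Unique.filter⁺ P? (Unique.upTo⁺ (suc b)) ,
    (λ m → mk⇔ (λ m∈ → proj₂ (∈-filter⁻ P? {xs = upTo (suc b)} m∈))
               (λ pm → ∈-filter⁺ P? (∈-upTo⁺ (s≤s (bound m pm))) pm)) ,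
    refl
    where
    xs : List ℕ
    xs = filter P? (upTo (suc b))

-- Without function extensionality, P must be assumed to respect pointwise equality.
anyFun? : ∀ {m n} {P : Pred (Fin m → Fin n) 0ℓ} →
          (∀ {f g} → f ≗ g → P f → P g) → Decidable P → Dec (∃ P)
anyFun? resp P? = map′
  (λ (i , p) → finToFun i , p)
  (λ (f , p) → funToFin f , resp (sym ∘ Fin.finToFun-funToFin f) p)
  (Fin.any? (P? ∘ finToFun))

module _ (G : Graph) where
  open Graph G using (Adj; adj?; loopless)

  Connected : Set
  Connected = ∀ u v → Star Adj u v

  -- The vertices are c 0, …, c (m - 1) in cyclic order; chords are allowed.
  record IsCycle (m : ℕ) (c : Fin m → Vertex G) : Set where
    constructor mkCycle
    field
      long     : 3 ≤ m
      distinct : Injective _≡_ _≡_ c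
      step     : ∀ i j → toℕ j ≡ suc (toℕ i) → Adj (c i) (c j)
      close    : ∀ i j → suc (toℕ i) ≡ m → toℕ j ≡ 0 → Adj (c i) (c j)

  Lₑ : Pred ℕ 0ℓ
  Lₑ m = 2 ∣ m × ∃ (IsCycle m)

  IsClique : Pred (Subset (order G)) 0ℓ
  IsClique S = ∀ u v → u ∈ S → v ∈ S → u ≢ v → Adj u v

  HasClique : Pred ℕ 0ℓ
  HasClique k = ∃[ S ] IsClique S × ∣ S ∣ ≡ k

  IsColouring : ∀ {k} → Pred (Vertex G → Fin k) 0ℓ
  IsColouring f = ∀ u v → Adj u v → f u ≢ f v

  Colourable : Pred ℕ 0ℓ
  Colourable k = ∃ (IsColouring {k})

  isCycle? : ∀ m → Decidable (IsCycle m)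
  isCycle? m c = map′
    (λ (l , d , s , e) → mkCycle l (λ {i} {j} → d i j) s e)
    (λ (mkCycle l d s e) → l , (λ i j → d {i} {j}) , s , e)
    (3 ≤? m
      ×-dec Fin.all? (λ i → Fin.all? λ j → (c i Fin.≟ c j) →-dec (i Fin.≟ j))
      ×-dec Fin.all? (λ i → Fin.all? λ j →
              (toℕ j ≟ suc (toℕ i)) →-dec adj? (c i) (c j))
      ×-dec Fin.all? (λ i → Fin.all? λ j →
              (suc (toℕ i) ≟ m) →-dec ((toℕ j ≟ 0) →-dec adj? (c i) (c j))))

  isCycle-resp : ∀ {m} {c d : Fin m → Vertex G} → c ≗ d → IsCycle m c → IsCycle m d
  isCycle-resp c≗d (mkCycle l inj s e) = mkCycle l
    (λ {i} {j} eq → inj (subst₂ _≡_ (sym (c≗d i)) (sym (c≗d j)) eq))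
    (λ i j p → subst₂ Adj (c≗d i) (c≗d j) (s i j p))
    (λ i j p q → subst₂ Adj (c≗d i) (c≗d j) (e i j p q))

  Lₑ? : Decidable Lₑ
  Lₑ? m = 2 ∣? m ×-dec anyFun? isCycle-resp (isCycle? m)

  Lₑ-bounded : ∀ m → Lₑ m → m ≤ order G
  Lₑ-bounded m (_ , _ , cyc) = Fin.injective⇒≤ (IsCycle.distinct cyc)

  hasClique? : Decidable HasClique
  hasClique? k = anySubset? λ S →
    Fin.all? (λ u → Fin.all? λ v →
      (u ∈? S) →-dec ((v ∈? S) →-dec (¬? (u Fin.≟ v) →-dec adj? u v)))
    ×-dec (∣ S ∣ ≟ k)

  hasClique-0 : HasClique 0
  hasClique-0 = ⊥ , (λ _ _ u∈⊥ → contradiction u∈⊥ ∉⊥) , ∣⊥∣≡0 (order G)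

  hasClique-bounded : ∀ k → HasClique k → k ≤ order G
  hasClique-bounded _ (S , _ , refl) = ∣p∣≤n S

  colourable? : Decidable Colourable
  colourable? k = anyFun?
    (λ f≗g col u v uv eq →
      col u v uv (subst₂ _≡_ (sym (f≗g u)) (sym (f≗g v)) eq))
    (λ f → Fin.all? λ u → Fin.all? λ v → adj? u v →-dec ¬? (f u Fin.≟ f v))

  colourable-order : Colourable (order G)
  colourable-order = id , λ { u .u uu refl → loopless u uu }

  evenCycleLengthCount : ∃ (HasCardinality Lₑ)
  evenCycleLengthCount = cardinality Lₑ? (order G) Lₑ-bounded

  cliqueNumber : ∃ (IsGreatest HasClique)
  cliqueNumber = greatest hasClique? (order G) hasClique-0 hasClique-bounded

  chromaticNumber : ∃ (IsLeast Colourable)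
  chromaticNumber = least colourable? colourable-order

  ∣Lₑ∣ : ℕ
  ∣Lₑ∣ = proj₁ evenCycleLengthCount

  ω : ℕ
  ω = proj₁ cliqueNumber

  χ : ℕ
  χ = proj₁ chromaticNumber

{-# OPTIONS --safe #-}

-- Let k = ∣Lₑ∣. In a counterexample on as few vertices as possible all degrees are at least 2k + 1, so the
-- first vertex v 0 of a longest path v has at least 2k + 1 neighbours, all on the path. Two neighbours at
-- positions of the same parity close an even cycle, and there are only k even lengths; hence the even lengths
-- are 2(1 + iτ) for 1 ≤ i ≤ k, and the positions of the neighbours of v 0 fill two arithmetic progressions of
-- k + 1 terms with at most one exception. If v 0 is adjacent to v (s + 1), then v s, …, v 0, v (s + 1), … is a
-- longest path too. Comparing the neighbours of v s and v 0 gives a 4-cycle, so τ = 1, and then that all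
-- neighbours of v 0 are among v 1, …, v (2k + 2). If no longest path attains 2k + 2, then v 0, …, v (2k + 1)
-- form a clique. Otherwise v 0, …, v (2k + 1) have no neighbours outside these 2k + 3 vertices and at most one
-- non-neighbour inside; in the absence of a clique on 2k + 2 vertices there are two disjoint pairs of
-- non-neighbours, so 2k + 1 colours suffice inside, and a transposition of colours makes the colour of
-- v (2k + 2) agree with that in a colouring of the rest of the graph.
module Submission where

open import Defs
open import Data.Empty using (⊥; ⊥-elim)
open import Data.Fin using (Fin; zero; suc; toℕ; fromℕ; fromℕ<; inject₁; punchOut)
open import Data.Fin.Patterns using (0F; 1F; 2F; 3F)
open import Data.Fin.Permutation.Components using (transpose; transpose-inverse)
import Data.Fin.Properties as Fin
open import Data.Fin.Subset as Subset using (Subset; inside; outside; ⁅_⁆; _∪_; ∣_∣)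
import Data.Fin.Subset.Properties as Subset
open import Data.List using (List; []; _∷_; _++_; length; filter; map; upTo; allFin)
open import Data.List.Membership.Propositional using (_∈_; find; lose)
open import Data.List.Membership.Propositional.Properties
  using (∈-filter⁺; ∈-filter⁻; ∈-upTo⁺; ∈-upTo⁻; ∈-map⁺; ∈-map⁻; ∈-++⁺ˡ; ∈-++⁺ʳ; ∈-allFin)
open import Data.List.Properties
  using (length-map; length-upTo; length-++; length-removeAt′; length-tabulate; filter-notAll)
open import Data.List.Relation.Binary.Subset.Propositional using (_⊆_)
open import Data.List.Relation.Unary.All as All using (All; []; _∷_)
import Data.List.Relation.Unary.All.Properties as All
open import Data.List.Relation.Unary.AllPairs as AllPairs using (AllPairs; []; _∷_)
import Data.List.Relation.Unary.AllPairs.Properties as AllPairs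
open import Data.List.Relation.Unary.Any as Any using (here; there; index; _─_)
open import Data.List.Relation.Unary.Unique.Propositional using (Unique)
import Data.List.Relation.Unary.Unique.Propositional.Properties as Unique
open import Data.Nat
open import Data.List.Membership.DecPropositional _≟_ using (_∈?_)
open import Data.Nat.Divisibility using (m∣m*n)
open import Data.Nat.Induction using (<-wellFounded)
open import Data.Nat.Properties
open import Data.Nat.Tactic.RingSolver using (solve-∀)
open import Data.Product using (∃; ∃-syntax; _×_; _,_; proj₁; proj₂)
open import Data.Sum using (_⊎_; inj₁; inj₂; [_,_]′)
open import Data.Vec as Vec using (_∷_)
open import Function using (_∘_; id)
open import Function.Bundles using (Equivalence)
open import Induction.WellFounded using (Acc; acc)
open import Relation.Binary.Definitions using (tri<; tri≈; tri>)
open import Relation.Binary.PropositionalEquality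
  using (_≡_; _≢_; refl; sym; trans; cong; cong₂; subst; subst₂)
open import Relation.Nullary using (¬_; Dec; yes; no; contradiction)
open import Relation.Nullary.Decidable using (¬?; _×-dec_; map′; decidable-stable; dec-true)

private variable
  A : Set

-- Linear arithmetic by certificates: A ≤ B is a sum of hypotheses and c the slack.
≤-cert : ∀ {A B a b} → A ≤ B → ∀ c → a + B + c ≡ b + A → a ≤ b
≤-cert {A} {B} {a} {b} A≤B c eq = +-cancelʳ-≤ B a b (begin
  a + B      ≤⟨ m≤m+n _ c ⟩
  a + B + c  ≡⟨ eq ⟩
  b + A      ≤⟨ +-monoʳ-≤ b A≤B ⟩
  b + B      ∎)
  where open ≤-Reasoning

⊥-cert : ∀ {A B} → A ≤ B → ∀ c → B + suc c ≡ A → ⊥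
⊥-cert {A} {B} A≤B c eq = <⇒≱ (m<m+n B z<s) (≤-trans (≤-reflexive eq) A≤B)

-- Counting with duplicate-free lists.

∈-─ : ∀ {x y : A} {ys} (y∈ : y ∈ ys) → x ∈ ys → x ≢ y → x ∈ (ys ─ y∈)
∈-─ (here refl) (here refl) x≢y = ⊥-elim (x≢y refl)
∈-─ (here refl) (there x∈)  x≢y = x∈
∈-─ (there y∈)  (here refl) x≢y = here refl
∈-─ (there y∈)  (there x∈)  x≢y = there (∈-─ y∈ x∈ x≢y)

-- Deleting one occurrence of the head from `ys` keeps every entry of the tail, since these all
-- differ from the head.
unique-⊆⇒length≤ : ∀ {xs ys : List A} → Unique xs → xs ⊆ ys → length xs ≤ length ys
unique-⊆⇒length≤ {xs = []} _ _ = z≤n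
unique-⊆⇒length≤ {xs = x ∷ xs} {ys} (x∉ ∷ xs!) sub =
  ≤-trans (s≤s (unique-⊆⇒length≤ xs! λ z∈ →
      ∈-─ x∈ (sub (there z∈)) λ z≡x → All.lookup x∉ z∈ (sym z≡x)))
    (≤-reflexive (sym (length-removeAt′ ys (index x∈))))
  where x∈ = sub (here refl)

-- Sets of differences that form arithmetic progressions.

-- If at most k numbers satisfy P and all differences within k + 1 increasing numbers x < y < … satisfy P, then
-- the differences from x are exactly the numbers with P. Measuring from y instead of x shows that P is
-- preserved by subtracting y ∸ x from any other such difference.
module Progression (P : ℕ → Set) (k : ℕ)
  (bound : ∀ ds → Unique ds → All P ds → length ds ≤ k) where

  Spread : List ℕ → Set
  Spread ms = AllPairs (λ x y → x < y × P (y ∸ x)) ms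

  private
    differences : ∀ {x} ys → Spread (x ∷ ys) →
      Unique (map (_∸ x) ys) × All P (map (_∸ x) ys)
    differences {x} ys (x<ys ∷ ys↗) =
      AllPairs.map⁺ (distinct x<ys ys↗) , All.map⁺ (All.map proj₂ x<ys)
      where
      distinct : ∀ {zs} → All (λ y → x < y × P (y ∸ x)) zs → Spread zs →
                 AllPairs (λ y z → y ∸ x ≢ z ∸ x) zs
      distinct [] [] = []
      distinct (p ∷ ps) (q ∷ qs) =
        All.zipWith (λ (r , s) eq → <⇒≢ (proj₁ s) (∸-cancelʳ-≡ (<⇒≤ (proj₁ p)) (<⇒≤ (proj₁ r)) eq))
          (ps , q) ∷ distinct ps qs

  spread-length : ∀ ms → Spread ms → length ms ≤ suc k
  spread-length [] _ = z≤n
  spread-length (x ∷ ys) sp = s≤s (≤-trans (≤-reflexive (sym (length-map _ ys)))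
    (bound _ (proj₁ (differences ys sp)) (proj₂ (differences ys sp))))

  progression : 2 ≤ k → ∀ ms → Spread ms → suc k ≤ length ms →
    ∃[ τ ] 0 < τ × ∀ d → P d → ∃[ i ] i < k × d ≡ suc i * τ
  progression 2≤k [] _ ()
  progression 2≤k (x ∷ []) _ (s≤s k≤0) = contradiction (≤-trans 2≤k k≤0) λ ()
  progression 2≤k (x ∷ y ∷ zs) sp@(x<yzs@((x<y , _) ∷ _) ∷ (y<zs ∷ _)) (s≤s k≤) = τ , τ>0 , multiple
    where
    τ = y ∸ x
    ds = map (_∸ x) (y ∷ zs)
    ds! = proj₁ (differences (y ∷ zs) sp)
    Pds = proj₂ (differences (y ∷ zs) sp)

    -- A value outside `ds` would give `k + 1` distinct numbers with `P`.
    complete : ∀ d → P d → d ∈ ds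
    complete d Pd with d ∈? ds
    ... | yes d∈ = d∈
    ... | no d∉ = contradiction
      (bound (d ∷ ds) (All.¬Any⇒All¬ ds d∉ ∷ ds!) (Pd ∷ Pds))
      (<⇒≱ (s≤s (≤-trans k≤ (≤-reflexive (sym (length-map (_∸ x) (y ∷ zs)))))))

    τ>0 : 0 < τ
    τ>0 = m<n⇒0<n∸m x<y

    descend : ∀ d → P d → d ≡ τ ⊎ ∃[ e ] P e × d ≡ e + τ
    descend d Pd with ∈-map⁻ (_∸ x) (complete d Pd)
    ... | _ , here refl , refl = inj₁ refl
    ... | z , there z∈ , refl with All.lookup y<zs z∈
    ...   | y<z , Pz = inj₂ (z ∸ y , Pz , sym (trans (sym (+-∸-assoc (z ∸ y) (<⇒≤ x<y)))
                              (cong (_∸ x) (m∸n+n≡m (<⇒≤ y<z)))))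

    -- Repeated descent by `τ` ends at `τ` itself, and every multiple of `τ` passed on the way
    -- satisfies `P`.
    chain : ∀ d → Acc _<_ d → P d → ∃[ i ] d ≡ suc i * τ × (∀ j → j ≤ i → P (suc j * τ))
    chain d (acc rec) Pd with descend d Pd
    ... | inj₁ refl = 0 , sym (*-identityˡ τ) , λ { .0 z≤n → subst P (sym (*-identityˡ τ)) Pd }
    ... | inj₂ (e , Pe , refl) with chain e (rec (m<m+n e τ>0)) Pe
    ...   | i , refl , all = suc i , +-comm (suc i * τ) τ , below
      where
      below : ∀ j → j ≤ suc i → P (suc j * τ)
      below j j≤ with m≤n⇒m<n∨m≡n j≤
      ... | inj₁ (s≤s j≤i) = all j j≤i
      ... | inj₂ refl = subst P (+-comm (suc i * τ) τ) Pd

    multiple : ∀ d → P d → ∃[ i ] i < k × d ≡ suc i * τ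
    multiple d Pd with chain d (<-wellFounded d) Pd
    -- The `i + 1` positive multiples of `τ` up to `d` are distinct and satisfy `P`, hence
    -- `i + 1 ≤ k`.
    ... | i , d≡ , all = i , ≤-trans (≤-reflexive (sym len)) (bound (map mul (upTo (suc i))) uniq alls) , d≡
      where
      mul : ℕ → ℕ
      mul j = suc j * τ
      len : length (map mul (upTo (suc i))) ≡ suc i
      len = trans (length-map mul (upTo (suc i))) (length-upTo (suc i))
      uniq : Unique (map mul (upTo (suc i)))
      uniq = Unique.map⁺ (λ {a} {b} eq → suc-injective (*-cancelʳ-≡ (suc a) (suc b) τ {{>-nonZero τ>0}} eq))
        (Unique.upTo⁺ (suc i))
      alls : All P (map mul (upTo (suc i)))
      alls = All.map⁺ (All.tabulate λ j∈ → all _ (≤-pred (∈-upTo⁻ j∈)))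

-- Reversal of an initial segment.

flip : ℕ → ℕ → ℕ
flip s i with i ≤? s
... | yes _ = s ∸ i
... | no  _ = i

flip-≤ : ∀ {s} i j → i + j ≡ s → flip s i ≡ j
flip-≤ {s} i j eq with i ≤? s
... | yes _ = trans (cong (_∸ i) (sym eq)) (m+n∸m≡n i j)
... | no i≰s = contradiction (≤-trans (m≤m+n i j) (≤-reflexive eq)) i≰s

flip-> : ∀ {s i} → s < i → flip s i ≡ i
flip-> {s} {i} s<i with i ≤? s
... | yes i≤s = contradiction i≤s (<⇒≱ s<i)
... | no _ = refl

≤-split : ∀ s i → (∃[ j ] i + j ≡ s) ⊎ s < i
≤-split s i with i ≤? s
... | yes i≤s = inj₁ (m≤n⇒∃[o]m+o≡n i≤s)
... | no i≰s = inj₂ (≰⇒> i≰s)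

flip-flip : ∀ s i → flip s (flip s i) ≡ i
flip-flip s i with ≤-split s i
... | inj₁ (j , eq) = trans (cong (flip s) (flip-≤ i j eq)) (flip-≤ j i (trans (+-comm j i) eq))
... | inj₂ s<i = trans (cong (flip s) (flip-> s<i)) (flip-> s<i)

flip-bound : ∀ {s i n} → s ≤ n → i ≤ n → flip s i ≤ n
flip-bound {s} {i} s≤n i≤n with i ≤? s
... | yes _ = ≤-trans (m∸n≤m s i) s≤n
... | no _ = i≤n

-- Paths, cycles and rotations.

module Walks (G : Graph) (xs : List (Vertex G)) where
  open Graph G using (Adj; adj?; symm; loopless)

  -- A path with `n` edges in the subgraph induced on `xs`. Values of `v` beyond `n` are arbitrary,
  -- so rerouting is composition with a map of `ℕ`.
  record Path (n : ℕ) (v : ℕ → Vertex G) : Set where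
    field
      inj  : ∀ {i j} → i ≤ n → j ≤ n → v i ≡ v j → i ≡ j
      step : ∀ {i} → i < n → Adj (v i) (v (suc i))
      mem  : ∀ {i} → i ≤ n → v i ∈ xs
  open Path public

  -- Indexed so that neighbours of `v 0` at positions `p` and `p + 2 d`, with `d > 0`, give
  -- `EvenCycle d`. The cycle may lie anywhere in `G`.
  EvenCycle : ℕ → Set
  EvenCycle d = ∃ (IsCycle G (2 * suc d))

  close-walk : ∀ {l d} (c : ℕ → Vertex G) → suc l ≡ 2 * suc d → 2 ≤ l →
    (∀ {i j} → i ≤ l → j ≤ l → c i ≡ c j → i ≡ j) →
    (∀ {i} → i < l → Adj (c i) (c (suc i))) → Adj (c l) (c 0) → EvenCycle d
  close-walk {l} {d} c eq 2≤l c-inj c-step c-close =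
    subst (λ m → ∃ (IsCycle G m)) eq (c ∘ toℕ , mkCycle (s≤s 2≤l)
      (λ {i} {j} e → Fin.toℕ-injective (c-inj (Fin.toℕ≤pred[n] i) (Fin.toℕ≤pred[n] j) e))
      (λ i j e → subst (λ m → Adj (c (toℕ i)) (c m)) (sym e)
        (c-step (subst (_≤ l) e (Fin.toℕ≤pred[n] j))))
      (λ i j e f → subst₂ (λ a b → Adj (c a) (c b)) (sym (suc-injective e)) (sym f) c-close))

  four-cycle : ∀ {a b c d} → Adj a b → Adj b c → Adj c d → Adj d a → a ≢ c → b ≢ d → EvenCycle 1
  four-cycle {a} {b} {c} {d} ab bc cd da a≢c b≢d = f , mkCycle (s≤s (s≤s (s≤s z≤n)))
    (λ {i} {j} → f-inj i j) f-step f-close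
    where
    f : Fin 4 → Vertex G
    f 0F = a
    f 1F = b
    f 2F = c
    f 3F = d
    adj⇒≢ : ∀ {x y} → Adj x y → x ≢ y
    adj⇒≢ xy refl = loopless _ xy
    f-inj : ∀ i j → f i ≡ f j → i ≡ j
    f-inj 0F 0F _ = refl
    f-inj 0F 1F e = contradiction e (adj⇒≢ ab)
    f-inj 0F 2F e = contradiction e a≢c
    f-inj 0F 3F e = contradiction (sym e) (adj⇒≢ da)
    f-inj 1F 0F e = contradiction (sym e) (adj⇒≢ ab)
    f-inj 1F 1F _ = refl
    f-inj 1F 2F e = contradiction e (adj⇒≢ bc)
    f-inj 1F 3F e = contradiction e b≢d
    f-inj 2F 0F e = contradiction (sym e) a≢c
    f-inj 2F 1F e = contradiction (sym e) (adj⇒≢ bc)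
    f-inj 2F 2F _ = refl
    f-inj 2F 3F e = contradiction e (adj⇒≢ cd)
    f-inj 3F 0F e = contradiction e (adj⇒≢ da)
    f-inj 3F 1F e = contradiction (sym e) b≢d
    f-inj 3F 2F e = contradiction (sym e) (adj⇒≢ cd)
    f-inj 3F 3F _ = refl
    f-step : ∀ i j → toℕ j ≡ suc (toℕ i) → Adj (f i) (f j)
    f-step 0F 1F _ = ab
    f-step 1F 2F _ = bc
    f-step 2F 3F _ = cd
    f-close : ∀ i j → suc (toℕ i) ≡ 4 → toℕ j ≡ 0 → Adj (f i) (f j)
    f-close 3F 0F _ _ = da
    f-close 3F (suc _) _ ()
    f-close 0F _ () _
    f-close 1F _ () _
    f-close 2F _ () _

  -- The cycle v 0, …, v s, v p, …, v (p + r), v 0.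
  chord-cycle : ∀ {n v d} s p r → Path n v → s < p → p + r ≤ n →
    Adj (v s) (v p) → Adj (v 0) (v (p + r)) → 1 ≤ d → s + r ≡ 2 * d → EvenCycle d
  chord-cycle {n} {v} {d} s p r path s<p p+r≤n sp 0q 1≤d s+r≡ =
    close-walk (v ∘ ψ) (trans (cong (λ m → suc (suc m)) s+r≡) (sym (*-suc 2 d)))
      (s≤s (≤-trans 1≤d (≤-trans (m≤m+n d _) (≤-reflexive (sym s+r≡)))))
      (λ i≤ j≤ e → ψ-inj (inj path (ψ-bound i≤) (ψ-bound j≤) e)) ψ-step
      (symm (subst (λ m → Adj (v 0) (v m)) (sym (ψ-> r)) 0q))
    where
    -- The position on the path of the `i`-th vertex of the cycle; after `s` it jumps to `p`.
    ψ : ℕ → ℕ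
    ψ i with i ≤? s
    ... | yes _ = i
    ... | no  _ = p + (i ∸ suc s)

    ψ-≤ : ∀ {i} → i ≤ s → ψ i ≡ i
    ψ-≤ {i} i≤s with i ≤? s
    ... | yes _ = refl
    ... | no i≰s = contradiction i≤s i≰s

    ψ-> : ∀ t → ψ (suc s + t) ≡ p + t
    ψ-> t with suc s + t ≤? s
    ... | yes le = contradiction (≤-trans (m≤m+n (suc s) t) le) 1+n≰n
    ... | no _ = cong (p +_) (m+n∸m≡n s t)

    data Range : ℕ → Set where
      low  : ∀ {i} → i ≤ s → Range i
      high : ∀ t → Range (suc s + t)

    range : ∀ i → Range i
    range i with i ≤? s
    ... | yes i≤s = low i≤s
    ... | no i≰s with m≤n⇒∃[o]m+o≡n (≰⇒> i≰s)
    ...   | t , refl = high t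

    ψ-bound : ∀ {i} → i ≤ suc s + r → ψ i ≤ n
    ψ-bound {i} i≤ with range i
    ... | low i≤s = subst (_≤ n) (sym (ψ-≤ i≤s))
                      (≤-trans i≤s (≤-trans (<⇒≤ s<p) (≤-trans (m≤m+n p r) p+r≤n)))
    ... | high t = subst (_≤ n) (sym (ψ-> t))
                      (≤-trans (+-monoʳ-≤ p (+-cancelˡ-≤ (suc s) t r i≤)) p+r≤n)

    low≢high : ∀ {i} t → i ≤ s → i ≢ p + t
    low≢high t i≤s refl = <⇒≱ s<p (≤-trans (m≤m+n p t) i≤s)

    ψ-inj : ∀ {i j} → ψ i ≡ ψ j → i ≡ j
    ψ-inj {i} {j} e with range i | range j
    ... | low a | low b = trans (sym (ψ-≤ a)) (trans e (ψ-≤ b))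
    ... | low a | high t = contradiction (trans (sym (ψ-≤ a)) (trans e (ψ-> t))) (low≢high t a)
    ... | high t | low b = contradiction (trans (sym (ψ-≤ b)) (trans (sym e) (ψ-> t))) (low≢high t b)
    ... | high t | high u = cong (suc s +_) (+-cancelˡ-≡ p t u (trans (sym (ψ-> t)) (trans e (ψ-> u))))

    ψ-step : ∀ {i} → i < suc s + r → Adj (v (ψ i)) (v (ψ (suc i)))
    ψ-step {i} i< with range i
    ... | high t = subst₂ (λ a b → Adj (v a) (v b)) (sym (ψ-> t))
      (sym (trans (cong ψ (sym (+-suc (suc s) t))) (trans (ψ-> (suc t)) (+-suc p t))))
      (step path (≤-trans (≤-trans (≤-reflexive (sym (+-suc p t)))
        (+-monoʳ-≤ p (+-cancelˡ-≤ (suc s) (suc t) r (≤-trans (≤-reflexive (+-suc (suc s) t)) i<)))) p+r≤n))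
    ... | low i≤s with m≤n⇒m<n∨m≡n i≤s
    ...   | inj₁ i<s = subst₂ (λ a b → Adj (v a) (v b)) (sym (ψ-≤ i≤s)) (sym (ψ-≤ i<s))
      (step path (≤-trans i<s (≤-trans (<⇒≤ s<p) (≤-trans (m≤m+n p r) p+r≤n))))
    ...   | inj₂ refl = subst₂ (λ a b → Adj (v a) (v b)) (sym (ψ-≤ ≤-refl))
      (sym (trans (cong ψ (sym (+-identityʳ (suc s)))) (trans (ψ-> 0) (+-identityʳ p)))) sp

  -- The Pósa rotation along an edge from `v 0` to `v (s + 1)`.
  reroute : ℕ → (ℕ → Vertex G) → ℕ → Vertex G
  reroute s v = v ∘ flip s

  reroute-path : ∀ {n v s} → Path n v → s < n → Adj (v 0) (v (suc s)) → Path n (reroute s v)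
  reroute-path {n} {v} {s} path s<n adj = record
    { inj = λ {i} {j} i≤ j≤ e → trans (sym (flip-flip s i)) (trans
        (cong (flip s) (inj path (flip-bound (<⇒≤ s<n) i≤) (flip-bound (<⇒≤ s<n) j≤) e)) (flip-flip s j))
    ; step = steps
    ; mem = λ i≤ → mem path (flip-bound (<⇒≤ s<n) i≤)
    }
    where
    steps : ∀ {i} → i < n → Adj (v (flip s i)) (v (flip s (suc i)))
    steps {i} i<n with ≤-split s i
    ... | inj₂ s<i = subst₂ (λ a b → Adj (v a) (v b)) (sym (flip-> s<i)) (sym (flip-> (m<n⇒m<1+n s<i)))
                       (step path i<n)
    -- Here `i = s`: the only new edge, from `v 0` to `v (s + 1)`.
    ... | inj₁ (zero , refl) = subst₂ (λ a b → Adj (v a) (v b)) (sym (flip-≤ i 0 refl))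
                       (sym (flip-> (s≤s (≤-reflexive (+-identityʳ i)))))
                       (subst (λ m → Adj (v 0) (v (suc m))) (+-identityʳ i) adj)
    ... | inj₁ (suc j , eq) = subst₂ (λ a b → Adj (v a) (v b)) (sym (flip-≤ i (suc j) eq))
                       (sym (flip-≤ (suc i) j (trans (sym (+-suc i j)) eq)))
                       (symm (step path (≤-trans (m≤n+m (suc j) i) (≤-trans (≤-reflexive eq) (<⇒≤ s<n)))))

  -- Excluding `n + 1` edges suffices, as a still longer path would contain such a path.
  Longest : ℕ → (ℕ → Vertex G) → Set
  Longest n v = Path n v × (∀ u → ¬ Path (suc n) u)

  -- Paths have distinct vertices, so at most `order G` extensions are possible. Whether a longer
  -- path exists is not decided, hence the doubly negated existence.
  longest-path : ∀ {x} → x ∈ xs → ¬ (∀ n v → ¬ Longest n v)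
  longest-path {x} x∈ none = extend (order G) 0 (λ _ → x)
    (record { inj = λ { z≤n z≤n _ → refl } ; step = λ () ; mem = λ _ → x∈ }) ≤-refl
    where
    extend : ∀ f n v → Path n v → order G ≤ n + f → ⊥
    extend zero n v path le = <⇒≱ (s≤s (≤-trans le (≤-reflexive (+-identityʳ n))))
      (Fin.injective⇒≤ {f = v ∘ toℕ {suc n}} λ {i} {j} e →
        Fin.toℕ-injective (inj path (Fin.toℕ≤pred[n] i) (Fin.toℕ≤pred[n] j) e))
    extend (suc f) n v path le = none n v (path , λ u p →
      extend f (suc n) u p (≤-trans le (≤-reflexive (+-suc n f))))

  -- Otherwise `y` put in front of `v 0` gives a longer path.
  neighbour-on-path : ∀ {n v y} → Longest n v → y ∈ xs → Adj (v 0) y → ∃[ i ] i ≤ n × y ≡ v i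
  neighbour-on-path {n} {v} {y} (path , max) y∈ adj
    with Fin.any? {n = suc n} (λ i → y Fin.≟ v (toℕ i))
  ... | yes (i , y≡) = toℕ i , Fin.toℕ≤pred[n] i , y≡
  ... | no off = ⊥-elim (max u record
    { inj = λ {i} {j} → u-inj i j ; step = λ {i} → u-step i ; mem = λ {i} → u-mem i })
    where
    off′ : ∀ {i} → i ≤ n → y ≢ v i
    off′ i≤n e = off (fromℕ< (s≤s i≤n) , trans e (cong v (sym (Fin.toℕ-fromℕ< (s≤s i≤n)))))
    u : ℕ → Vertex G
    u zero = y
    u (suc i) = v i
    u-inj : ∀ i j → i ≤ suc n → j ≤ suc n → u i ≡ u j → i ≡ j
    u-inj zero zero _ _ _ = refl
    u-inj zero (suc j) _ (s≤s j≤) e = contradiction e (off′ j≤)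
    u-inj (suc i) zero (s≤s i≤) _ e = contradiction (sym e) (off′ i≤)
    u-inj (suc i) (suc j) (s≤s i≤) (s≤s j≤) e = cong suc (inj path i≤ j≤ e)
    u-step : ∀ i → i < suc n → Adj (u i) (u (suc i))
    u-step zero _ = symm adj
    u-step (suc i) (s≤s i<) = step path i<
    u-mem : ∀ i → i ≤ suc n → u i ∈ xs
    u-mem zero _ = y∈
    u-mem (suc i) (s≤s i≤) = mem path i≤

  record Nb (n : ℕ) (v : ℕ → Vertex G) (i : ℕ) : Set where
    constructor _,_
    field
      within : i ≤ n
      joined : Adj (v 0) (v i)
  open Nb public

  Nb? : ∀ n v i → Dec (Nb n v i)
  Nb? n v i = map′ (λ (i≤n , adj) → i≤n , adj) (λ (i≤n , adj) → i≤n , adj)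
    (i ≤? n ×-dec adj? (v 0) (v i))

  reroute-longest : ∀ {n v} s → Longest n v → Nb n v (suc s) → Longest n (reroute s v)
  reroute-longest s (path , max) (s<n , adj) = reroute-path path s<n adj , max

  -- Only `v m` can have neighbours in `xs` outside the lobe; `almost` says that each of the other
  -- vertices has at most one non-neighbour inside.
  record Lobe (m : ℕ) (v : ℕ → Vertex G) : Set where
    field
      distinct : ∀ {i j} → i ≤ m → j ≤ m → v i ≡ v j → i ≡ j
      member   : ∀ {i} → i ≤ m → v i ∈ xs
      closed   : ∀ {j y} → j < m → y ∈ xs → Adj (v j) y → ∃[ i ] i ≤ m × y ≡ v i
      almost   : ∀ {j a b} → j < m → a ≤ m → b ≤ m → a ≢ b → a ≢ j → b ≢ j →
                 Adj (v j) (v a) ⊎ Adj (v j) (v b)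

-- Neighbours of the first vertex of a longest path.

halve : ∀ i → ∃[ m ] (i ≡ 2 * m ⊎ i ≡ 1 + 2 * m)
halve zero = 0 , inj₁ refl
halve (suc i) with halve i
... | m , inj₁ refl = m , inj₂ refl
... | m , inj₂ refl = suc m , inj₁ (sym (*-suc 2 m))

module Minimal (G : Graph) (xs : List (Vertex G)) (xs! : Unique xs) (k : ℕ) (3≤k : 3 ≤ k)
  (lengths-bound : ∀ ds → Unique ds → All (Walks.EvenCycle G xs) ds → length ds ≤ k)
  (degree-bound : ∀ {x} → x ∈ xs → suc (2 * k) ≤ length (filter (Graph.adj? G x) xs))
  (n : ℕ) where

  open Graph G using (Adj; adj?; symm; loopless)
  open Walks G xs
  open Progression EvenCycle k lengths-bound

  ¬Nb0 : ∀ {v} → ¬ Nb n v 0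
  ¬Nb0 (_ , adj) = loopless _ adj

  positions : (ℕ → Vertex G) → List ℕ
  positions v = filter (Nb? n v) (upTo (suc n))

  ∈-positions : ∀ {v i} → Nb n v i → i ∈ positions v
  ∈-positions {v} nb = ∈-filter⁺ (Nb? n v) (∈-upTo⁺ (s≤s (within nb))) nb

  positions-length : ∀ {v} → Longest n v → suc (2 * k) ≤ length (positions v)
  positions-length {v} L@(path , _) = begin
    suc (2 * k)                    ≤⟨ degree-bound (mem path z≤n) ⟩
    length (filter (adj? (v 0)) xs) ≤⟨ unique-⊆⇒length≤ (Unique.filter⁺ (adj? (v 0)) xs!) sub ⟩
    length (map v (positions v))   ≡⟨ length-map v (positions v) ⟩
    length (positions v)           ∎
    where
    open ≤-Reasoning
    sub : filter (adj? (v 0)) xs ⊆ map v (positions v)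
    sub y∈ with ∈-filter⁻ (adj? (v 0)) {xs = xs} y∈
    ... | y∈xs , adj with neighbour-on-path L y∈xs adj
    ...   | i , i≤n , refl = ∈-map⁺ v (∈-positions (i≤n , adj))

  -- With both missing, at most `2k` entries of `W` would be left for at least `2k + 1` neighbours.
  at-most-one-missing : ∀ {v} → Longest n v → ∀ W → length W ≤ 2 + 2 * k → (∀ {i} → Nb n v i → i ∈ W) →
    ∀ {a b} → a ≢ b → a ∈ W → b ∈ W → Nb n v a ⊎ Nb n v b
  at-most-one-missing {v} L W W≤ cover {a} {b} a≢b a∈ b∈ with Nb? n v a | Nb? n v b
  ... | yes nb | _ = inj₁ nb
  ... | no _ | yes nb = inj₂ nb
  ... | no ¬a | no ¬b = contradiction
    (≤-trans (s≤s (s≤s (positions-length L))) (≤-trans (unique-⊆⇒length≤ unique sub) W≤)) 1+n≰n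
    where
    nb-of : ∀ {i} → i ∈ positions v → Nb n v i
    nb-of i∈ = proj₂ (∈-filter⁻ (Nb? n v) {xs = upTo (suc n)} i∈)
    unique : Unique (a ∷ b ∷ positions v)
    unique = (a≢b ∷ All.tabulate λ i∈ → λ { refl → ¬a (nb-of i∈) })
      ∷ (All.tabulate λ i∈ → λ { refl → ¬b (nb-of i∈) })
      ∷ Unique.filter⁺ (Nb? n v) (Unique.upTo⁺ (suc n))
    sub : a ∷ b ∷ positions v ⊆ W
    sub (here refl) = a∈
    sub (there (here refl)) = b∈
    sub (there (there i∈)) = cover (nb-of i∈)

  -- `f` enumerates the even or the odd positions. The arguments `m` are stored instead of the
  -- positions, so that their differences are indices of `EvenCycle`.
  module ParityClass (f : ℕ → ℕ) (f-expand : ∀ m d → f (m + d) ≡ f m + 2 * d) where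

    class : (ℕ → Vertex G) → List ℕ
    class v = filter (λ m → Nb? n v (f m)) (upTo (suc n))

    class-nb : ∀ {v m} → m ∈ class v → Nb n v (f m)
    class-nb {v} m∈ = proj₂ (∈-filter⁻ (λ m → Nb? n v (f m)) {xs = upTo (suc n)} m∈)

    ∈-class : ∀ {v m} → Nb n v (f m) → m ∈ class v
    ∈-class {v} {m} nb = ∈-filter⁺ (λ m → Nb? n v (f m)) (∈-upTo⁺ (s≤s m≤n)) nb
      where
      m≤n : m ≤ n
      m≤n = ≤-trans (≤-trans (m≤m+n m (m + 0)) (m≤n+m (2 * m) (f 0)))
              (≤-trans (≤-reflexive (sym (f-expand 0 m))) (within nb))

    class-spread : ∀ {v} → Longest n v → Spread (class v)
    class-spread {v} (path , _) = go (class v) class-nb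
      (AllPairs.filter⁺ (λ m → Nb? n v (f m)) (AllPairs.applyUpTo⁺₁ id (suc n) λ i<j _ → i<j))
      where
      cycle : ∀ {x y} → Nb n v (f x) → Nb n v (f y) → x < y → EvenCycle (y ∸ x)
      -- With `s = 0` the chord cycle is `v 0` followed by the stretch from `f x` to `f y`.
      cycle {x} {y} nx ny x<y = chord-cycle 0 (f x) (2 * (y ∸ x)) path
        (n≢0⇒n>0 λ e → ¬Nb0 {v} (subst (Nb n v) e nx))
        (subst (_≤ n) fy (within ny)) (joined nx) (subst (λ i → Adj (v 0) (v i)) fy (joined ny))
        (m<n⇒0<n∸m x<y) refl
        where
        fy : f y ≡ f x + 2 * (y ∸ x)
        fy = trans (cong f (sym (m+[n∸m]≡n (<⇒≤ x<y)))) (f-expand x (y ∸ x))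
      go : ∀ ms → (∀ {m} → m ∈ ms → Nb n v (f m)) → AllPairs _<_ ms → Spread ms
      go [] _ [] = []
      go (x ∷ ms) nbs (x< ∷ ms↗) =
        All.tabulate (λ y∈ → All.lookup x< y∈ , cycle (nbs (here refl)) (nbs (there y∈)) (All.lookup x< y∈))
        ∷ go ms (nbs ∘ there) ms↗

  module Even = ParityClass (λ m → 2 * m) (λ m d → *-distribˡ-+ 2 m d)
  module Odd = ParityClass (λ m → 1 + 2 * m) (λ m d → cong suc (*-distribˡ-+ 2 m d))

  class-lengths : ∀ {v} → Longest n v → suc (2 * k) ≤ length (Even.class v) + length (Odd.class v)
  class-lengths {v} L = begin
    suc (2 * k)              ≤⟨ positions-length L ⟩
    length (positions v)     ≤⟨ unique-⊆⇒length≤ (Unique.filter⁺ (Nb? n v) (Unique.upTo⁺ (suc n))) sub ⟩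
    length (es ++ os)        ≡⟨ length-++ es ⟩
    length es + length os    ≡⟨ cong (_+ length os) (length-map _ (Even.class v)) ⟩
    length (Even.class v) + length os ≡⟨ cong (length (Even.class v) +_) (length-map _ (Odd.class v)) ⟩
    length (Even.class v) + length (Odd.class v) ∎
    where
    open ≤-Reasoning
    es = map (λ m → 2 * m) (Even.class v)
    os = map (λ m → 1 + 2 * m) (Odd.class v)
    sub : positions v ⊆ es ++ os
    sub {i} i∈ with proj₂ (∈-filter⁻ (Nb? n v) {xs = upTo (suc n)} i∈) | halve i
    ... | nb | m , inj₁ refl = ∈-++⁺ˡ (∈-map⁺ (λ m → 2 * m) (Even.∈-class {v} {m} nb))
    ... | nb | m , inj₂ refl = ∈-++⁺ʳ es (∈-map⁺ (λ m → 1 + 2 * m) (Odd.∈-class {v} {m} nb))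

  -- At least `2k + 1` neighbours fall into two parity classes, so one class has `k + 1` members.
  lengths-progression : ∀ {v} → Longest n v →
    ∃[ τ ] 0 < τ × ∀ d → EvenCycle d → ∃[ i ] i < k × d ≡ suc i * τ
  lengths-progression {v} L with suc k ≤? length (Even.class v)
  ... | yes big = progression (≤-trans (n≤1+n 2) 3≤k) (Even.class v) (Even.class-spread L) big
  ... | no small = progression (≤-trans (n≤1+n 2) 3≤k) (Odd.class v) (Odd.class-spread L)
    (≤-cert (+-mono-≤ (class-lengths L) (≰⇒> small)) 0 (e k (length (Even.class v)) (length (Odd.class v))))
    where
    e : ∀ k a b → suc k + (a + b + suc k) + 0 ≡ b + (suc (2 * k) + suc a)
    e = solve-∀

  -- The spacing of the even cycle lengths.

  module Spaced (τ : ℕ) (0<τ : 0 < τ)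
    (multiple : ∀ {d} → EvenCycle d → ∃[ i ] i < k × d ≡ suc i * τ) where

    -- The candidate positions: `2 ε` will be the first even position of a neighbour, while the odd
    -- candidates begin at 1.
    E : ℕ → ℕ → ℕ
    E ε i = 2 * (ε + i * τ)

    O : ℕ → ℕ
    O i = 1 + 2 * (i * τ)

    -- There are 2k + 2 candidate positions E ε i and O i (i ≤ k) for at least 2k + 1 neighbours of v 0, whence the
    -- last three fields.
    record Window (v : ℕ → Vertex G) (ε : ℕ) : Set where
      field
        head : Nb n v (2 * ε)
        even : ∀ m → Nb n v (2 * m) → ∃[ i ] i ≤ k × m ≡ ε + i * τ
        odd  : ∀ m → Nb n v (1 + 2 * m) → ∃[ i ] i ≤ k × m ≡ i * τ
        EE   : ∀ {i j} → i < j → j ≤ k → Nb n v (E ε i) ⊎ Nb n v (E ε j)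
        OO   : ∀ {i j} → i < j → j ≤ k → Nb n v (O i) ⊎ Nb n v (O j)
        EO   : ∀ {i j} → i ≤ k → j ≤ k → Nb n v (E ε i) ⊎ Nb n v (O j)
    open Window public

    window : ∀ {v} → Longest n v → ∃ (Window v)
    window {v} L with Even.class v in eq | Even.class-spread L
    -- All `2k + 1` neighbours would be at odd positions, but a parity class has at most `k + 1`
    -- members.
    ... | [] | _ = contradiction (Odd.class-spread L) λ sp → ⊥-cert
      (+-mono-≤ (subst (λ ms → suc (2 * k) ≤ length ms + length (Odd.class v)) eq (class-lengths L))
        (+-mono-≤ (spread-length (Odd.class v) sp) 3≤k)) 2 (e k (length (Odd.class v)))
      where
      e : ∀ k b → b + (suc k + k) + 3 ≡ suc (2 * k) + (b + 3)
      e = solve-∀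
    ... | ε ∷ rest | ε<rest ∷ _ = ε , record
      { head = hd
      ; even = ev
      ; odd = od
      ; EE = λ {i} {j} i<j j≤k → miss (<⇒≢ (*-monoʳ-< 2 (+-monoʳ-< ε (*-monoˡ-< τ {{>-nonZero 0<τ}} i<j))))
               (E∈ (≤-trans (<⇒≤ i<j) j≤k)) (E∈ j≤k)
      ; OO = λ {i} {j} i<j j≤k → miss (<⇒≢ (s≤s (*-monoʳ-< 2 (*-monoˡ-< τ {{>-nonZero 0<τ}} i<j))))
               (O∈ (≤-trans (<⇒≤ i<j) j≤k)) (O∈ j≤k)
      ; EO = λ {i} {j} i≤k j≤k → miss (even≢odd (ε + i * τ) (j * τ)) (E∈ i≤k) (O∈ j≤k)
      }
      where
      hd : Nb n v (2 * ε)
      hd = Even.class-nb {v} (subst (ε ∈_) (sym eq) (here refl))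

      ev : ∀ m → Nb n v (2 * m) → ∃[ i ] i ≤ k × m ≡ ε + i * τ
      ev m nb with subst (m ∈_) eq (Even.∈-class {v} {m} nb)
      ... | here refl = 0 , z≤n , sym (+-identityʳ ε)
      ... | there m∈ with All.lookup ε<rest m∈
      ...   | ε<m , cyc with multiple cyc
      ...     | i , i<k , e = suc i , i<k , trans (sym (m+[n∸m]≡n (<⇒≤ ε<m))) (cong (ε +_) e)

      od : ∀ m → Nb n v (1 + 2 * m) → ∃[ i ] i ≤ k × m ≡ i * τ
      od zero _ = 0 , z≤n , refl
      -- Differences are taken from position 1, as `v 1` is a neighbour of `v 0`.
      od (suc m) nb with multiple (chord-cycle 0 1 (2 * suc m) (proj₁ L) z<s (within nb)
                           (step (proj₁ L) (≤-trans (s≤s z≤n) (within nb))) (joined nb) (s≤s z≤n) refl)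
      ... | i , i<k , e = suc i , i<k , e

      W = map (E ε) (upTo (suc k)) ++ map O (upTo (suc k))

      E∈ : ∀ {i} → i ≤ k → E ε i ∈ W
      E∈ i≤k = ∈-++⁺ˡ (∈-map⁺ (E ε) (∈-upTo⁺ (s≤s i≤k)))

      O∈ : ∀ {i} → i ≤ k → O i ∈ W
      O∈ i≤k = ∈-++⁺ʳ (map (E ε) (upTo (suc k))) (∈-map⁺ O (∈-upTo⁺ (s≤s i≤k)))

      cover : ∀ {i} → Nb n v i → i ∈ W
      cover {i} nb with halve i
      ... | m , inj₁ refl with ev m nb
      ...   | j , j≤k , refl = E∈ j≤k
      cover {i} nb | m , inj₂ refl with od m nb
      ...   | j , j≤k , refl = O∈ j≤k

      W-length : length W ≤ 2 + 2 * k
      W-length = ≤-reflexive (trans (length-++ (map (E ε) (upTo (suc k))))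
        (trans (cong₂ _+_ (len (E ε)) (len O)) (e k)))
        where
        len : ∀ (f : ℕ → ℕ) → length (map f (upTo (suc k))) ≡ suc k
        len f = trans (length-map f (upTo (suc k))) (length-upTo (suc k))
        e : ∀ k → suc k + suc k ≡ 2 + 2 * k
        e = solve-∀

      miss : ∀ {a b} → a ≢ b → a ∈ W → b ∈ W → Nb n v a ⊎ Nb n v b
      miss = at-most-one-missing L W W-length cover

    nonzero : ∀ {v m} → Nb n v (2 * m) → 0 < m
    nonzero {v} {zero} nb = contradiction nb (¬Nb0 {v})
    nonzero {m = suc _} _ = z<s

    reroute-nb> : ∀ {v s p} → s < p → Nb n (reroute s v) p → Adj (v s) (v p)
    reroute-nb> {v} {s} s<p (_ , adj) =
      subst₂ (λ a b → Adj (v a) (v b)) (flip-≤ 0 s refl) (flip-> s<p) adj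

    reroute-nb≤ : ∀ {v s} i j → i + j ≡ s → Nb n (reroute s v) i → Adj (v s) (v j)
    reroute-nb≤ {v} {s} i j eq (_ , adj) =
      subst₂ (λ a b → Adj (v a) (v b)) (flip-≤ 0 s refl) (flip-≤ i j eq) adj

    nb-reroute> : ∀ {v s p} → s < p → p ≤ n → Adj (v s) (v p) → Nb n (reroute s v) p
    nb-reroute> {v} {s} s<p p≤n adj = p≤n ,
      subst₂ (λ a b → Adj (v a) (v b)) (sym (flip-≤ 0 s refl)) (sym (flip-> s<p)) adj

    -- The cycle v 0, v (2 τ + 1), v (2 τ), v (O j) for j = 2 or 3.
    four-cycle-odd : ∀ {v} → Longest n v → Nb n v (O 1) → Nb n v (O 2) → Nb n v (O 3) → EvenCycle 1
    four-cycle-odd {v} L nb₁ nb₂ nb₃ =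
      -- The rotated path starts at `v (2 τ)` and misses at most one candidate, so `O 2` or `O 3` is
      -- available.
      [ finish 2 ≤-refl nb₂ , finish 3 (s≤s (s≤s z≤n)) nb₃ ]′
        (OO (proj₂ (window (reroute-longest s L nb₁))) {2} {3} ≤-refl 3≤k)
      where
      s = 2 * (1 * τ)
      finish : ∀ j → 1 < j → Nb n v (O j) → Nb n (reroute s v) (O j) → EvenCycle 1
      finish j 1<j nbv nbw = four-cycle (joined nb₁) (symm (step (proj₁ L) (within nb₁)))
        (reroute-nb> {v} (<-trans (n<1+n s) O₁<Oⱼ) nbw) (symm (joined nbv))
        (λ e → <⇒≢ (≤-trans 0<τ (≤-trans (m≤m+n τ 0) (m≤m+n (1 * τ) _)))
                  (inj (proj₁ L) z≤n (≤-trans (n≤1+n s) (within nb₁)) e))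
        (λ e → <⇒≢ O₁<Oⱼ (inj (proj₁ L) (within nb₁) (within nbv) e))
        where
        O₁<Oⱼ : O 1 < O j
        O₁<Oⱼ = s≤s (*-monoʳ-< 2 (*-monoˡ-< τ {{>-nonZero 0<τ}} 1<j))

    -- The cycle v 0, v (2 ε), v (2 ε - 1), v (E ε j) for j = 1 or 2, unless v (2 ε - 1) has, in the rerouted path,
    -- a neighbour at an even position before 2 ε, which closes a cycle that is too long.
    four-cycle-even : ∀ {v ε} → Longest n v → Window v ε → (∀ j → j ≤ k → Nb n v (E ε j)) → EvenCycle 1
    four-cycle-even {v} {ε} L@(path , _) V full
      with m≤n⇒∃[o]m+o≡n (≤-trans (nonzero {v} (head V)) (m≤m+n ε (ε + 0)))
    ... | s , s+1≡2ε = go (even Vw ε (nb-reroute> {v} s<2ε (within (head V)) edge))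
      where
      first : Nb n v (suc s)
      first = subst (Nb n v) (sym s+1≡2ε) (head V)
      Lw = reroute-longest s L first
      w = reroute s v
      ε′ = proj₁ (window Lw)
      Vw : Window w ε′
      Vw = proj₂ (window Lw)
      s<2ε : s < 2 * ε
      s<2ε = ≤-reflexive s+1≡2ε
      edge : Adj (v s) (v (2 * ε))
      edge = subst (λ i → Adj (v s) (v i)) s+1≡2ε (step path (within first))
      finish : ∀ j → 1 ≤ j → j ≤ k → Nb n w (E ε j) → EvenCycle 1
      finish j 1≤j j≤k nbw = four-cycle (joined (head V)) (symm edge)
        (reroute-nb> {v} (≤-trans s<2ε (<⇒≤ 2ε<Eⱼ)) nbw) (symm (joined (full j j≤k)))
        (λ e → even≢odd ε 0 (trans (sym s+1≡2ε)
                  (cong suc (sym (inj path z≤n (≤-trans (n≤1+n s) (within first)) e)))))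
        (λ e → <⇒≢ 2ε<Eⱼ (inj path (within (head V)) (within (full j j≤k)) e))
        where
        2ε<Eⱼ : 2 * ε < E ε j
        2ε<Eⱼ = *-monoʳ-< 2 (m<m+n ε (≤-trans 0<τ (≤-trans (m≤m+n τ 0) (*-monoˡ-≤ τ 1≤j))))
      go : ∃[ i ] i ≤ k × ε ≡ ε′ + i * τ → EvenCycle 1
      -- If `ε′ = ε`, the even candidates of both paths coincide, and one of the next two is a
      -- neighbour of `v s`.
      go (zero , _ , eq) with EE Vw {1} {2} ≤-refl (≤-trans (n≤1+n 2) 3≤k)
      ... | inj₁ nb = finish 1 ≤-refl (≤-trans (s≤s z≤n) 3≤k)
                        (subst (λ ε → Nb n w (E ε 1)) (sym (trans eq (+-identityʳ ε′))) nb)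
      ... | inj₂ nb = finish 2 (s≤s z≤n) (≤-trans (n≤1+n 2) 3≤k)
                        (subst (λ ε → Nb n w (E ε 2)) (sym (trans eq (+-identityʳ ε′))) nb)
      go (suc i , _ , eq) with ≤-split s (2 * ε′)
      ... | inj₂ s<2ε′ = contradiction (≤-trans (≤-reflexive (sym s+1≡2ε)) s<2ε′)
              (<⇒≱ (*-monoʳ-< 2 (≤-trans (m<m+n ε′ (≤-trans 0<τ (m≤m+n τ (i * τ)))) (≤-reflexive (sym eq)))))
      -- Here `w (2 ε′)` is `v s₀`, a neighbour of `v s`. The cycle `v 0`, ..., `v s₀`, `v s`, ...,
      -- `v (E ε k)` has index `(1 + i + k) τ`, beyond the maximum `k τ`.
      ... | inj₁ (s₀ , e₀) = ⊥-elim (too-long (multiple (chord-cycle s₀ s (1 + 2 * (k * τ)) path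
              (≤-trans (+-monoˡ-≤ s₀ (≤-trans (nonzero {w} (head Vw)) (m≤m+n ε′ (ε′ + 0)))) (≤-reflexive e₀))
              (subst (_≤ n) end (within (full k ≤-refl)))
              (symm (reroute-nb≤ {v} (2 * ε′) s₀ e₀ (head Vw)))
              (subst (λ i → Adj (v 0) (v i)) end (joined (full k ≤-refl)))
              (≤-trans 0<τ (m≤m+n τ ((i + k) * τ)))
              (+-cancelˡ-≡ (2 * ε′) _ _ (trans (e₁ ε′ s₀ (k * τ)) (trans
                 (cong (λ x → suc x + 2 * (k * τ)) e₀) (trans (cong (_+ 2 * (k * τ)) s+1≡2ε)
                 (trans (cong (λ x → 2 * x + 2 * (k * τ)) eq) (e₂ ε′ i k τ))))))))) 
        where
        end : E ε k ≡ s + (1 + 2 * (k * τ))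
        end = trans (*-distribˡ-+ 2 ε (k * τ)) (trans (cong (_+ 2 * (k * τ)) (sym s+1≡2ε)) (sym (+-suc s _)))
        e₁ : ∀ a b c → 2 * a + (b + (1 + 2 * c)) ≡ suc (2 * a + b) + 2 * c
        e₁ = solve-∀
        e₂ : ∀ a i k t → 2 * (a + suc i * t) + 2 * (k * t) ≡ 2 * a + 2 * (suc (i + k) * t)
        e₂ = solve-∀
        too-long : ∃[ j ] j < k × suc (i + k) * τ ≡ suc j * τ → ⊥
        too-long (j , j<k , e) = <⇒≱ j<k
          (≤-trans (m≤n+m k i) (≤-reflexive (suc-injective
             (*-cancelʳ-≡ (suc (i + k)) (suc j) τ {{>-nonZero 0<τ}} e))))

    -- `O i` is already the one missing candidate.
    evens-full : ∀ {v ε i} → Window v ε → i ≤ k → ¬ Nb n v (O i) → ∀ j → j ≤ k → Nb n v (E ε j)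
    evens-full V i≤k ¬nb j j≤k = [ id , (λ nb → contradiction nb ¬nb) ]′ (EO V j≤k i≤k)

    -- Either `O 1`, `O 2`, `O 3` are all neighbours, or one of them is the missing candidate and
    -- all even candidates are neighbours.
    shortest-four-cycle : ∀ {v} → Longest n v → EvenCycle 1
    shortest-four-cycle {v} L with window L
    ... | ε , V with Nb? n v (O 1) | Nb? n v (O 2) | Nb? n v (O 3)
    ...   | yes nb₁ | yes nb₂ | yes nb₃ = four-cycle-odd L nb₁ nb₂ nb₃
    ...   | no ¬nb | _ | _ = four-cycle-even L V (evens-full V (≤-trans (s≤s z≤n) 3≤k) ¬nb)
    ...   | yes _ | no ¬nb | _ = four-cycle-even L V (evens-full V (≤-trans (n≤1+n 2) 3≤k) ¬nb)
    ...   | yes _ | yes _ | no ¬nb = four-cycle-even L V (evens-full V 3≤k ¬nb)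

    -- The index 1 of a 4-cycle is a multiple of `τ`.
    spacing-one : ∀ {v} → Longest n v → τ ≡ 1
    spacing-one L with multiple (shortest-four-cycle L)
    ... | i , _ , eq = m*n≡1⇒n≡1 (suc i) τ (sym eq)

  -- Confining the neighbours to the first 2k + 3 vertices.

  module UnitSpaced (multiple : ∀ {d} → EvenCycle d → ∃[ i ] i < k × d ≡ suc i * 1) where

    open Spaced 1 z<s multiple

    short : ∀ {d} → EvenCycle d → d ≤ k
    short cyc with multiple cyc
    ... | i , i<k , refl = subst (_≤ k) (sym (*-identityʳ (suc i))) i<k

    even₁ : ∀ {v ε} → Window v ε → ∀ m → Nb n v (2 * m) → ∃[ i ] i ≤ k × m ≡ ε + i
    even₁ {ε = ε} V m nb with even V m nb
    ... | i , i≤k , eq = i , i≤k , trans eq (cong (ε +_) (*-identityʳ i))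

    odd₁ : ∀ {v ε} → Window v ε → ∀ m → Nb n v (1 + 2 * m) → m ≤ k
    odd₁ V m nb with odd V m nb
    ... | i , i≤k , eq = ≤-trans (≤-reflexive (trans eq (*-identityʳ i))) i≤k

    EE₁ : ∀ {v ε i j} → Window v ε → i < j → j ≤ k → Nb n v (2 * (ε + i)) ⊎ Nb n v (2 * (ε + j))
    EE₁ {v} {ε} {i} {j} V i<j j≤k = subst₂ (λ a b → Nb n v (2 * (ε + a)) ⊎ Nb n v (2 * (ε + b)))
      (*-identityʳ i) (*-identityʳ j) (EE V i<j j≤k)

    OO₁ : ∀ {v ε i j} → Window v ε → i < j → j ≤ k → Nb n v (1 + 2 * i) ⊎ Nb n v (1 + 2 * j)
    OO₁ {v} {ε} {i} {j} V i<j j≤k = subst₂ (λ a b → Nb n v (1 + 2 * a) ⊎ Nb n v (1 + 2 * b))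
      (*-identityʳ i) (*-identityʳ j) (OO V i<j j≤k)

    EO₁ : ∀ {v ε i j} → Window v ε → i ≤ k → j ≤ k → Nb n v (2 * (ε + i)) ⊎ Nb n v (1 + 2 * j)
    EO₁ {v} {ε} {i} {j} V i≤k j≤k = subst₂ (λ a b → Nb n v (2 * (ε + a)) ⊎ Nb n v (1 + 2 * b))
      (*-identityʳ i) (*-identityʳ j) (EO V i≤k j≤k)

    1≤k : 1 ≤ k
    1≤k = ≤-trans (s≤s z≤n) 3≤k

    2≤k : 2 ≤ k
    2≤k = ≤-trans (n≤1+n 2) 3≤k

    -- At most one candidate is missing, so one of the last two even ones is a neighbour.
    late-even : ∀ {v ε} → Window v ε → ∃[ i ] k ≤ suc i × Nb n v (2 * (ε + i))
    late-even V with m≤n⇒∃[o]m+o≡n 1≤k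
    ... | k′ , refl with EE₁ {i = k′} {j = suc k′} V ≤-refl ≤-refl
    ...   | inj₁ nb = k′ , ≤-refl , nb
    ...   | inj₂ nb = suc k′ , n≤1+n _ , nb

    -- Neighbours v (2 x) of w 0 = v (2 σ) and v (2 y) of v 0 close the cycle v 0, …, v (2 σ), v (2 x), …, v (2 y)
    -- of length 2 (1 + σ + ∣ x - y ∣).
    module Crossing {v} (L : Longest n v) (σ : ℕ) (0<σ : 0 < σ) (nbσ : Nb n v (1 + 2 * σ)) where

      w : ℕ → Vertex G
      w = reroute (2 * σ) v

      Lw : Longest n w
      Lw = reroute-longest (2 * σ) L nbσ

      private
        σ≤k : σ ≤ k
        σ≤k = odd₁ (proj₂ (window L)) σ nbσ

        w-nb : ∀ {x} → σ < x → Nb n w (2 * x) → Adj (v (2 * σ)) (v (2 * x))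
        w-nb σ<x = reroute-nb> {v} (*-monoʳ-< 2 σ<x)

        -- The same walk read from w 0 = v (2 σ), where w (2 σ) = v 0.
        nb-w : ∀ {x} → σ < x → Nb n v (2 * x) → Adj (w (2 * σ)) (w (2 * x))
        nb-w σ<x (_ , adj) = subst₂ (λ a b → Adj (v a) (v b))
          (sym (flip-≤ (2 * σ) 0 (+-identityʳ _))) (sym (flip-> (*-monoʳ-< 2 σ<x))) adj

        cross : ∀ {u x y} → Longest n u → σ < x → Adj (u (2 * σ)) (u (2 * x)) → Nb n u (2 * y) → y + σ ≤ x + k
        cross {u} {x} {y} Lu σ<x adj nb with ≤-total x y
        ... | inj₂ y≤x = +-mono-≤ y≤x σ≤k
        ... | inj₁ x≤y with m≤n⇒∃[o]m+o≡n x≤y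
        ...   | t , refl = subst₂ _≤_ (regroup x σ t) refl (+-monoʳ-≤ x (short
                (chord-cycle {d = σ + t} (2 * σ) (2 * x) (2 * t)
                  (proj₁ Lu) (*-monoʳ-< 2 σ<x) (subst (_≤ n) (*-distribˡ-+ 2 x t) (within nb)) adj
                  (subst (λ i → Adj (u 0) (u i)) (*-distribˡ-+ 2 x t) (joined nb))
                  (≤-trans 0<σ (m≤m+n σ t)) (sym (*-distribˡ-+ 2 σ t)))))
          where
          regroup : ∀ x σ t → x + (σ + t) ≡ x + t + σ
          regroup = solve-∀

      crossʳ : ∀ {x y} → σ < x → Nb n w (2 * x) → Nb n v (2 * y) → y + σ ≤ x + k
      crossʳ σ<x nbw nbv = cross L σ<x (w-nb σ<x nbw) nbv

      crossˡ : ∀ {x y} → σ < y → Nb n w (2 * x) → Nb n v (2 * y) → x + σ ≤ y + k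
      crossˡ σ<y nbw nbv = cross Lw σ<y (nb-w σ<y nbv) nbw

    -- The rotated path starts at `v 2`. If `ε′ ≥ 2`, one crossing cycle gives `ε′ > ε`, and the
    -- other, through a late neighbour of `v 2`, gives `ε′ ≤ ε`.
    no-chord-3 : ∀ {v ε} → Longest n v → Window v ε → 2 ≤ ε → Nb n v 3 → ¬ Nb n v (2 * (ε + k))
    no-chord-3 {v} {ε} L V 2≤ε nb₃ nb = go (window Lw)
      where
      open Crossing L 1 z<s nb₃
      arith : ∀ k ε ε′ i → ε′ + k + (ε + k + suc i) + 1 ≡ ε + k + 1 + (ε′ + i + 1 + k)
      arith = solve-∀
      go : ∃ (Window w) → ⊥
      go (0 , W) = ¬Nb0 {w} (head W)
      -- `w 2` is `v 0`, so `v 2` would be a neighbour of `v 0` before position `2 ε`.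
      go (1 , W) with even₁ V 1 (z≤n-within , symm (reroute-nb≤ {v} 2 0 refl (head W)))
        where
        z≤n-within : 2 ≤ n
        z≤n-within = ≤-trans (n≤1+n 2) (within nb₃)
      ... | i , _ , eq = <⇒≱ 2≤ε (≤-trans (m≤m+n ε i) (≤-reflexive (sym eq)))
      go (ε′@(suc (suc _)) , W) with late-even W
      ... | i , k≤1+i , late = ⊥-cert
        (+-mono-≤ (crossʳ {ε′} {ε + k} (s≤s (s≤s z≤n)) (head W) nb)
                  (+-mono-≤ (crossˡ {ε′ + i} {ε} 2≤ε late (head V)) k≤1+i)) 0 (arith k ε ε′ i)

    -- The rotated path starts at `v 4`. If `ε′ ≥ 3`, two crossing cycles through late neighbours
    -- give `i + j + 4 ≤ 2k`, against `k ≤ i + 1` and `k ≤ j + 1`.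
    no-chord-5 : ∀ {v ε} → Longest n v → Window v ε → 3 ≤ ε → ¬ Nb n v 5
    no-chord-5 {v} {ε} L V 3≤ε nb₅ = go (window Lw)
      where
      open Crossing L 2 z<s nb₅
      arith : ∀ k ε ε′ i j → ε′ + k + (ε + k + (suc i + suc j)) + 2 ≡ ε + i + 2 + (ε′ + j + 2 + (k + k))
      arith = solve-∀
      arith₃ : ∀ k ε i → ε + (3 + k + suc i) + 0 ≡ 2 + (ε + i + 2 + k)
      arith₃ = solve-∀
      ¬nbw₄ : ¬ Nb n w 4
      ¬nbw₄ nb with even₁ V 2 (≤-trans (n≤1+n 4) (within nb₅) , symm (reroute-nb≤ {v} 4 0 refl nb))
      ... | i , _ , eq = <⇒≱ 3≤ε (≤-trans (m≤m+n ε i) (≤-reflexive (sym eq)))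
      go : ∃ (Window w) → ⊥
      go (0 , W) = ¬Nb0 {w} (head W)
      -- Positions 2 and 4 lie in the reversed segment, where no crossing cycle arises, and 4 is not
      -- a neighbour. So position 6 replaces the head.
      go (1 , W) with EE₁ {i = 1} {j = 2} W ≤-refl 2≤k | late-even V
      ... | inj₁ nb | _ = ¬nbw₄ nb
      ... | inj₂ nb | i , k≤1+i , late = <⇒≱ 3≤ε (≤-cert
        (+-mono-≤ (crossʳ {3} {ε + i} ≤-refl nb late) k≤1+i) 0 (arith₃ k ε i))
      go (2 , W) = ¬nbw₄ (head W)
      go (ε′@(suc (suc (suc _))) , W) with late-even V | late-even W
      ... | i , k≤1+i , lv | j , k≤1+j , lw = ⊥-cert
        (+-mono-≤ (crossʳ {ε′} {ε + i} (s≤s (s≤s (s≤s z≤n))) (head W) lv)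
          (+-mono-≤ (crossˡ {ε′ + j} {ε} 3≤ε lw (head V)) (+-mono-≤ k≤1+i k≤1+j))) 1 (arith k ε ε′ i j)

    -- Otherwise v 3 is adjacent to v 5, and v 0, …, v 3, v 5, …, v (2 k + 4) is a cycle of length 2 k + 4.
    chord-3 : ∀ {v} → Longest n v → Window v 2 → Nb n v (2 * (2 + k)) → Nb n v 3
    chord-3 {v} L V nb with Nb? n v 3
    ... | yes nb₃ = nb₃
    ... | no ¬nb₃ with m≤n⇒∃[o]m+o≡n 1≤k
    ...   | k′ , refl = contradiction (short {1 + suc k′}
                (chord-cycle {d = 1 + suc k′} 3 5 (1 + 2 * k′) (proj₁ L) (n≤1+n 4)
                (subst (_≤ n) (p k′) (within nb)) (reroute-nb> {v} (n≤1+n 4) nbw)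
                (subst (λ i → Adj (v 0) (v i)) (p k′) (joined nb)) (s≤s z≤n) (q k′))) (1+n≰n {suc k′})
      where
      Lw = reroute-longest 3 L (head V)
      p : ∀ k′ → 2 * (2 + suc k′) ≡ 5 + (1 + 2 * k′)
      p = solve-∀
      q : ∀ k′ → 3 + (1 + 2 * k′) ≡ 2 * (1 + suc k′)
      q = solve-∀
      nbw : Nb n (reroute 3 v) 5
      nbw with OO₁ {i = 1} {j = 2} (proj₂ (window Lw)) ≤-refl 2≤k
      ... | inj₂ nb₅ = nb₅
      ... | inj₁ nb₃ = contradiction
        (≤-trans (n≤1+n 3) (within (head V)) , symm (reroute-nb≤ {v} 3 0 refl nb₃)) ¬nb₃

    -- For `ε = 2` only `i = k` is to be excluded: it forces the chord to `v 3`, which in turn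
    -- forbids it. `ε ≥ 3` is impossible: position 5 is missing, so position 3 and the last even
    -- candidate are both neighbours.
    late-even-bound : ∀ {v ε} → Longest n v → Window v ε → 2 ≤ ε → ∀ i → Nb n v (2 * (ε + i)) → ε + i ≤ suc k
    late-even-bound {v} {ε} L V 2≤ε i nb with m≤n⇒m<n∨m≡n 2≤ε
    ... | inj₂ refl with even₁ V (2 + i) nb
    ...   | j , j≤k , eq with m≤n⇒m<n∨m≡n (subst (_≤ k) (sym (+-cancelˡ-≡ 2 i j eq)) j≤k)
    ...     | inj₁ i<k = s≤s i<k
    ...     | inj₂ refl = contradiction nb (no-chord-3 L V ≤-refl (chord-3 L V nb))
    late-even-bound {v} {ε} L V 2≤ε i nb | inj₁ 3≤ε
      with OO₁ {i = 1} {j = 2} V ≤-refl 2≤k | EO₁ {i = k} {j = 2} V ≤-refl 2≤k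
    ... | inj₂ nb₅ | _ = contradiction nb₅ (no-chord-5 L V 3≤ε)
    ... | inj₁ _ | inj₂ nb₅ = contradiction nb₅ (no-chord-5 L V 3≤ε)
    ... | inj₁ nb₃ | inj₁ late = contradiction late (no-chord-3 L V 2≤ε nb₃)

    Nb-bound : ∀ {v i} → Longest n v → Nb n v i → i ≤ 2 + 2 * k
    Nb-bound {v} {i} L nb with halve i | window L
    ... | m , inj₂ refl | ε , V = s≤s (≤-trans (*-monoʳ-≤ 2 (odd₁ V m nb)) (n≤1+n _))
    ... | m , inj₁ refl | ε , V = ≤-trans (*-monoʳ-≤ 2 (bound ε V (even₁ V m nb))) (≤-reflexive (*-suc 2 k))
      where
      bound : ∀ ε → Window v ε → ∃[ i ] i ≤ k × m ≡ ε + i → m ≤ suc k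
      bound zero V _ = contradiction (head V) (¬Nb0 {v})
      bound 1 V (i , i≤k , refl) = s≤s i≤k
      bound ε@(suc (suc _)) V (i , _ , refl) = late-even-bound L V (s≤s (s≤s z≤n)) i nb

    -- By `Nb-bound`, at least `2k + 1` neighbours occupy the positions 1 to `2k + 2`.
    dense : ∀ {v i j} → Longest n v → i ≢ j → 1 ≤ i → 1 ≤ j → i ≤ 2 + 2 * k → j ≤ 2 + 2 * k →
      Nb n v i ⊎ Nb n v j
    dense {v} L i≢j 1≤i 1≤j i≤ j≤ = at-most-one-missing L W
      (≤-reflexive (trans (length-map suc (upTo (2 + 2 * k))) (length-upTo (2 + 2 * k))))
      (λ {i} nb → ∈W {i} (n≢0⇒n>0 λ { refl → ¬Nb0 {v} nb }) (Nb-bound L nb)) i≢j (∈W 1≤i i≤) (∈W 1≤j j≤)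
      where
      W = map suc (upTo (2 + 2 * k))
      ∈W : ∀ {i} → 1 ≤ i → i ≤ 2 + 2 * k → i ∈ W
      ∈W {suc i} _ i≤ = ∈-map⁺ suc (∈-upTo⁺ i≤)

    -- A clique or a lobe at the start of the path.

    private
      K = 2 + 2 * k

    -- If `K` is always the missing position, the first vertex of any longest path is adjacent to
    -- positions 1 to `K - 1`. A rotation brings `v a` to the front and leaves later vertices in
    -- place.
    initial-clique : (∀ v → Longest n v → ¬ Nb n v K) →
      ∀ {v} → Longest n v → ∀ {a b} → a < b → b < K → Adj (v a) (v b)
    initial-clique none {v} L {a} {b} a<b b<K = reroute-nb> {v} a<b
      (all (reroute-longest a L (all L z<s (≤-<-trans a<b b<K))) (≤-trans (s≤s z≤n) a<b) b<K)
      where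
      all : ∀ {u i} → Longest n u → 1 ≤ i → i < K → Nb n u i
      all {u} Lu 1≤i i<K = [ id , (λ nb → contradiction nb (none u Lu)) ]′
        (dense Lu (<⇒≢ i<K) 1≤i z<s (<⇒≤ i<K) ≤-refl)

    module InitialLobe {v} (L : Longest n v) (nbK : Nb n v K) where

      -- The invariant of rotations at `s < K`: the first `K + 1` vertices are permuted among
      -- themselves.
      record Front (w : ℕ → Vertex G) : Set where
        field
          longest : Longest n w
          from    : ∀ {i} → i ≤ K → ∃[ j ] j ≤ K × w j ≡ v i
          into    : ∀ {i} → i ≤ K → ∃[ j ] j ≤ K × w i ≡ v j
      open Front

      front-v : Front v
      front-v = record { longest = L ; from = λ {i} i≤ → i , i≤ , refl ; into = λ {i} i≤ → i , i≤ , refl }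

      reroute-front : ∀ {w} s → Front w → s < K → Nb n w (suc s) → Front (reroute s w)
      reroute-front {w} s F s<K nb = record
        { longest = reroute-longest s (longest F) nb
        ; from = λ i≤ → let (j , j≤ , eq) = from F i≤ in
            flip s j , flip-bound (<⇒≤ s<K) j≤ , trans (cong w (flip-flip s j)) eq
        ; into = λ i≤ → into F (flip-bound (<⇒≤ s<K) i≤)
        }

      others : ∀ {w i j} → Front w → ¬ Nb n w i → i ≢ j → 1 ≤ i → 1 ≤ j → i ≤ K → j ≤ K → Nb n w j
      others F ¬nb i≢j 1≤i 1≤j i≤ j≤ = [ (λ nb → contradiction nb ¬nb) , id ]′
        (dense (longest F) i≢j 1≤i 1≤j i≤ j≤)

      nb₁ : Nb n v 1
      nb₁ = 1≤n , step (proj₁ L) 1≤n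
        where 1≤n = ≤-trans (s≤s z≤n) (within nbK)

      3<K : 3 < K
      3<K = s≤s (s≤s (≤-trans 2≤k (m≤m+n k (k + 0))))

      -- One rotation suffices if `v (j + 1)` is a neighbour of `v 0`. Otherwise `j + 1` is the only
      -- missing position, and two rotations along other chords bring `v j` to the front.
      start : ∀ {j} → j < K → ∃[ w ] Front w × w 0 ≡ v j
      start {j} j<K with Nb? n v (suc j)
      ... | yes nb = reroute j v , reroute-front j front-v j<K nb , cong v (flip-≤ 0 j refl)
      ... | no ¬nb = via j refl
        where
        2+j≤K : 2 + j ≤ K
        -- `j + 1 = K` is excluded because `v K` is a neighbour of `v 0`.
        2+j≤K = ≤∧≢⇒< j<K λ { refl → ¬nb nbK }
        nb : ∀ i → suc j ≢ i → 1 ≤ i → i ≤ K → Nb n v i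
        nb i ≢i 1≤i i≤K = others front-v ¬nb ≢i z<s 1≤i j<K i≤K
        via : ∀ i → j ≡ i → ∃[ w ] Front w × w 0 ≡ v j
        via 0 refl = contradiction nb₁ ¬nb
        -- The path becomes `v 3`, `v 2`, `v 1`, `v 0`, `v 4`, ... and then `v 1`, `v 2`, `v 3`,
        -- `v 0`, `v 4`, ....
        via 1 refl = reroute 2 w , reroute-front 2 F (<-trans (n<1+n 2) 3<K) nbw , refl
          where
          w = reroute 3 v
          F = reroute-front 3 front-v 3<K (nb 4 (λ ()) z<s 3<K)
          nb₃ = nb 3 (λ ()) z<s (<⇒≤ 3<K)
          nbw : Nb n w 3
          nbw = within nb₃ , symm (joined nb₃)
        -- First `v 1`, `v 0`, `v 2`, ..., then a rotation along the edge from `v 1` to `v (j + 1)`.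
        -- That edge exists because `v (j + 1)`, as the start of `u`, already misses `v 0`.
        via (suc (suc i)) refl = reroute j w , reroute-front j F j<K nbw ,
          trans (cong w (flip-≤ 0 j refl)) (cong v (flip-> (s≤s z<s)))
          where
          w = reroute 1 v
          F = reroute-front 1 front-v (≤-trans (s≤s (s≤s z≤n)) 3<K)
            (nb 2 (λ ()) z<s (≤-trans (n≤1+n 2) (<⇒≤ 3<K)))
          u = reroute (suc j) v
          nb₂₊ⱼ = nb (2 + j) (λ ()) z<s 2+j≤K
          Fu = reroute-front (suc j) front-v 2+j≤K nb₂₊ⱼ
          ¬nbu : ¬ Nb n u (suc j)
          ¬nbu n₀ = ¬nb (≤-trans (n≤1+n _) (within nb₂₊ⱼ) , symm (reroute-nb≤ {v} (suc j) 0 (+-identityʳ _) n₀))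
          edge : Adj (v (suc j)) (v 1)
          edge = reroute-nb≤ {v} j 1 (+-comm j 1) (others Fu ¬nbu 1+n≢n z<s z<s j<K (<⇒≤ j<K))
          nbw : Nb n w (suc j)
          nbw = nb-reroute> {v} (s≤s z<s) (≤-trans (n≤1+n _) (within nb₂₊ⱼ)) (symm edge)

      -- Each `v j` with `j < K` starts a longest path with the same first `K + 1` vertices, to
      -- which `Nb-bound` and `dense` apply.
      lobe : Lobe K v
      lobe = record
        { distinct = λ i≤ j≤ → inj (proj₁ L) (≤-trans i≤ (within nbK)) (≤-trans j≤ (within nbK))
        ; member = λ i≤ → mem (proj₁ L) (≤-trans i≤ (within nbK))
        ; closed = closed
        ; almost = almost
        }
        where
        closed : ∀ {j y} → j < K → y ∈ xs → Adj (v j) y → ∃[ i ] i ≤ K × y ≡ v i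
        closed {j} {y} j<K y∈ adj with start j<K
        ... | w , F , w0≡ with neighbour-on-path (longest F) y∈ (subst (λ x → Adj x y) (sym w0≡) adj)
        ...   | i , i≤n , refl with into F (Nb-bound (longest F) (i≤n , subst (λ x → Adj x (w i)) (sym w0≡) adj))
        ...     | l , l≤K , eq = l , l≤K , eq
        almost : ∀ {j a b} → j < K → a ≤ K → b ≤ K → a ≢ b → a ≢ j → b ≢ j → Adj (v j) (v a) ⊎ Adj (v j) (v b)
        almost {j} {a} {b} j<K a≤K b≤K a≢b a≢j b≢j with start j<K
        ... | w , F , w0≡ with from F a≤K | from F b≤K
        ...   | p , p≤K , wp≡ | q , q≤K , wq≡ = convert
            (dense (longest F) p≢q (pos wp≡ a≤K a≢j) (pos wq≡ b≤K b≢j) p≤K q≤K)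
          where
          v-inj : ∀ {i l} → i ≤ K → l ≤ K → v i ≡ v l → i ≡ l
          v-inj i≤ l≤ = inj (proj₁ L) (≤-trans i≤ (within nbK)) (≤-trans l≤ (within nbK))
          pos : ∀ {i c} → w i ≡ v c → c ≤ K → c ≢ j → 1 ≤ i
          pos {zero} wi≡ c≤K c≢j = contradiction (v-inj c≤K (<⇒≤ j<K) (trans (sym wi≡) w0≡)) c≢j
          pos {suc i} _ _ _ = z<s
          p≢q : p ≢ q
          p≢q refl = a≢b (v-inj a≤K b≤K (trans (sym wp≡) wq≡))
          convert : Nb n w p ⊎ Nb n w q → Adj (v j) (v a) ⊎ Adj (v j) (v b)
          convert (inj₁ nb) = inj₁ (subst₂ Adj w0≡ wp≡ (joined nb))
          convert (inj₂ nb) = inj₂ (subst₂ Adj w0≡ wq≡ (joined nb))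

  lobe-or-clique : ∀ {v} → Longest n v → (∀ u → ¬ Lobe (2 + 2 * k) u) →
    (∀ u → ¬ (∀ {a b} → a < b → b < 2 + 2 * k → Adj (u a) (u b))) → ⊥
  lobe-or-clique {v} L ¬lobe ¬clique with lengths-progression L
  ... | τ , 0<τ , multiple with Spaced.spacing-one τ 0<τ (multiple _) L
  ...   | refl = ¬clique v (initial-clique (λ u Lu nb → ¬lobe u (InitialLobe.lobe Lu nb)) L)
    where open UnitSpaced (multiple _)

-- Merging and permuting colours.

merge : ∀ {n} (x y : Fin (suc n)) → x ≢ y →
  ∃[ f ] ∀ i j → f i ≡ f j → i ≡ j ⊎ (i ≡ x × j ≡ y) ⊎ (i ≡ y × j ≡ x)
merge {n} x y x≢y = f , f-merge
  where
  f : Fin (suc n) → Fin n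
  f i with i Fin.≟ y
  ... | yes _ = punchOut (x≢y ∘ sym)
  ... | no i≢y = punchOut (i≢y ∘ sym)
  f-merge : ∀ i j → f i ≡ f j → i ≡ j ⊎ (i ≡ x × j ≡ y) ⊎ (i ≡ y × j ≡ x)
  f-merge i j e with i Fin.≟ y | j Fin.≟ y
  ... | yes i≡y | yes j≡y = inj₁ (trans i≡y (sym j≡y))
  ... | yes i≡y | no j≢y = inj₂ (inj₂ (i≡y , sym (Fin.punchOut-injective (x≢y ∘ sym) (j≢y ∘ sym) e)))
  ... | no i≢y | yes j≡y = inj₂ (inj₁ (Fin.punchOut-injective (i≢y ∘ sym) (x≢y ∘ sym) e , j≡y))
  ... | no i≢y | no j≢y = inj₁ (Fin.punchOut-injective (i≢y ∘ sym) (j≢y ∘ sym) e)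

transpose-injective : ∀ {n} (a b : Fin n) {i j} → transpose a b i ≡ transpose a b j → i ≡ j
transpose-injective a b {i} {j} e =
  trans (sym (transpose-inverse b a)) (trans (cong (transpose b a) e) (transpose-inverse b a))

transpose-matchˡ : ∀ {n} (a b : Fin n) → transpose a b a ≡ b
transpose-matchˡ a b rewrite dec-true (a Fin.≟ a) refl = refl

∣⁅x⁆∪p∣≡1+∣p∣ : ∀ {n} (x : Fin n) (p : Subset n) → x Subset.∉ p → ∣ ⁅ x ⁆ ∪ p ∣ ≡ suc ∣ p ∣
∣⁅x⁆∪p∣≡1+∣p∣ zero (inside ∷ p) x∉p = contradiction Vec.here x∉p
∣⁅x⁆∪p∣≡1+∣p∣ zero (outside ∷ p) x∉p = cong (suc ∘ ∣_∣) (Subset.∪-identityˡ p)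
∣⁅x⁆∪p∣≡1+∣p∣ (suc x) (inside ∷ p) x∉p = cong suc (∣⁅x⁆∪p∣≡1+∣p∣ x p (x∉p ∘ Vec.there))
∣⁅x⁆∪p∣≡1+∣p∣ (suc x) (outside ∷ p) x∉p = ∣⁅x⁆∪p∣≡1+∣p∣ x p (x∉p ∘ Vec.there)

-- Cliques and partial colourings.

module Colouring (G : Graph) where
  open Graph G using (Adj; adj?; symm; loopless)

  -- Distinctness of the first `m` vertices follows from looplessness.
  SequenceClique : ℕ → (ℕ → Vertex G) → Set
  SequenceClique m u = ∀ {a b} → a < b → b < m → Adj (u a) (u b)

  sequenceClique⇒hasClique : ∀ {m u} → SequenceClique m u → HasClique G m
  sequenceClique⇒hasClique {m} {u} clique with image m clique
    where
    image : ∀ l → SequenceClique l u → ∃[ S ] ∣ S ∣ ≡ l × (∀ {x} → x Subset.∈ S → ∃[ a ] a < l × x ≡ u a)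
    image zero _ = Subset.⊥ , Subset.∣⊥∣≡0 (order G) , λ x∈ → contradiction x∈ Subset.∉⊥
    image (suc l) clq with image l (λ a<b b<l → clq a<b (m<n⇒m<1+n b<l))
    ... | S , S≡ , mem = ⁅ u l ⁆ ∪ S ,
      trans (∣⁅x⁆∪p∣≡1+∣p∣ (u l) S λ ul∈ → let (a , a<l , eq) = mem ul∈ in
        loopless _ (subst (Adj (u a)) eq (clq a<l ≤-refl))) (cong suc S≡) ,
      λ x∈ → [ (λ x∈⁅⁆ → l , ≤-refl , Subset.x∈⁅y⁆⇒x≡y _ x∈⁅⁆)
             , (λ x∈S → let (a , a<l , eq) = mem x∈S in a , m<n⇒m<1+n a<l , eq) ]′ (Subset.x∈p∪q⁻ ⁅ u l ⁆ S x∈)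
  ... | S , S≡m , mem = S , S-clique , S≡m
    where
    S-clique : IsClique G S
    S-clique x y x∈ y∈ x≢y with mem x∈ | mem y∈
    ... | a , a<m , refl | b , b<m , refl with <-cmp a b
    ...   | tri< a<b _ _ = clique a<b b<m
    ...   | tri≈ _ refl _ = contradiction refl x≢y
    ...   | tri> _ _ b<a = symm (clique b<a a<m)

  nonadjacent-pair : ∀ m u → ¬ SequenceClique m u → ∃[ b ] b < m × ∃[ a ] a < b × ¬ Adj (u a) (u b)
  nonadjacent-pair m u ¬clique
    with anyUpTo? (λ b → anyUpTo? (λ a → ¬? (adj? (u a) (u b))) b) m
  ... | yes found = found
  ... | no none = contradiction
    (λ {a} {b} a<b b<m → decidable-stable (adj? (u a) (u b)) λ ¬adj → none (b , b<m , a , a<b , ¬adj)) ¬clique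

  -- Colourings of the subgraph induced on `xs`; colours elsewhere are arbitrary.
  ColourableOn : ℕ → List (Vertex G) → Set
  ColourableOn m xs = ∃ λ (f : Vertex G → Fin m) → ∀ {u v} → u ∈ xs → v ∈ xs → Adj u v → f u ≢ f v

  differs? : ∀ (x y : Vertex G) → Dec (y ≢ x)
  differs? x y = ¬? (y Fin.≟ x)

  -- Fewer than `m` neighbours leave a colour free for `x`.
  extend-low-degree : ∀ {m x xs} → length (filter (adj? x) xs) < m →
    ColourableOn m (filter (differs? x) xs) → ColourableOn m xs
  extend-low-degree {m} {x} {xs} low (f , proper)
    with Fin.¬∀⟶∃¬ m (_∈ used) (λ c → Any.any? (c Fin.≟_) used) ¬all
    where
    used : List (Fin m)
    used = map f (filter (adj? x) xs)
    ¬all : ¬ (∀ c → c ∈ used)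
    ¬all all = <⇒≱ low (begin
      m                            ≡⟨ length-tabulate id ⟨
      length (allFin m)            ≤⟨ unique-⊆⇒length≤ (Unique.allFin⁺ m) (λ {c} _ → all c) ⟩
      length used                  ≡⟨ length-map f (filter (adj? x) xs) ⟩
      length (filter (adj? x) xs)  ∎)
      where open ≤-Reasoning
  ... | c , c∉used = g , g-proper
    where
    g : Vertex G → Fin m
    g y with y Fin.≟ x
    ... | yes _ = c
    ... | no _ = f y
    avoids : ∀ {y} → y ∈ xs → Adj x y → c ≢ f y
    avoids y∈ adj refl = c∉used (∈-map⁺ f (∈-filter⁺ (adj? x) y∈ adj))
    g-proper : ∀ {u v} → u ∈ xs → v ∈ xs → Adj u v → g u ≢ g v
    g-proper {u} {v} u∈ v∈ adj with u Fin.≟ x | v Fin.≟ x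
    ... | yes refl | yes refl = contradiction adj (loopless _)
    ... | yes refl | no _ = avoids v∈ adj
    ... | no _ | yes refl = avoids u∈ (symm adj) ∘ sym
    ... | no u≢x | no v≢x = proper (∈-filter⁺ (differs? x) u∈ u≢x) (∈-filter⁺ (differs? x) v∈ v≢x) adj

  -- Extending a colouring over a lobe.

  module LobeExtension {m xs v} (lobe : Walks.Lobe G xs (suc m) v)
    (¬clique : ∀ u → ¬ SequenceClique (suc m) u) where
    open Walks.Lobe lobe

    -- The increasing enumeration of the natural numbers other than `a`.
    skip : ℕ → ℕ → ℕ
    skip a i with i <? a
    ... | yes _ = i
    ... | no _ = suc i

    skip≢ : ∀ a i → skip a i ≢ a
    skip≢ a i eq with i <? a
    ... | yes i<a = <⇒≢ i<a eq
    ... | no i≮a = i≮a (≤-reflexive eq)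

    skip-≤ : ∀ a i → skip a i ≤ suc i
    skip-≤ a i with i <? a
    ... | yes _ = n≤1+n i
    ... | no _ = ≤-refl

    skip-mono : ∀ a {i j} → i < j → skip a i < skip a j
    skip-mono a {i} {j} i<j with i <? a | j <? a
    ... | yes _ | yes _ = i<j
    ... | yes _ | no _ = m<n⇒m<1+n i<j
    ... | no i≮a | yes j<a = contradiction (<-trans i<j j<a) i≮a
    ... | no _ | no _ = s≤s i<j

    record DisjointNonEdges : Set where
      constructor disjointNonEdges
      field
        {a b c d} : ℕ
        a≤ : a ≤ suc m
        b≤ : b ≤ suc m
        c≤ : c ≤ suc m
        d≤ : d ≤ suc m
        a≢b : a ≢ b
        c≢d : c ≢ d
        c≢a : c ≢ a
        c≢b : c ≢ b
        d≢a : d ≢ a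
        d≢b : d ≢ b
        ¬ab : ¬ Adj (v a) (v b)
        ¬cd : ¬ Adj (v c) (v d)

    -- The second pair avoids a by choice and b because b < m + 1 has only the non-neighbour a.
    disjoint-non-edges : DisjointNonEdges
    disjoint-non-edges with nonadjacent-pair (suc m) v (¬clique v)
    -- The `m + 1` lobe vertices other than `v a` do not form a clique either.
    ... | b , b<m , a , a<b , ¬ab with nonadjacent-pair (suc m) (v ∘ skip a) (¬clique (v ∘ skip a))
    ...   | j , j<m , i , i<j , ¬ij = disjointNonEdges
      (<⇒≤ (<-trans a<b b<m)) (<⇒≤ b<m) i≤ j≤ (<⇒≢ a<b) i≢j (skip≢ a i)
      (λ e → only j≤ (skip≢ a j) (λ e′ → i≢j (trans e (sym e′))) λ adj →
        ¬ij (subst (λ x → Adj (v x) (v (skip a j))) (sym e) adj))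
      (skip≢ a j)
      (λ e → only i≤ (skip≢ a i) (λ e′ → i≢j (trans e′ (sym e))) λ adj →
        ¬ij (symm (subst (λ x → Adj (v x) (v (skip a i))) (sym e) adj)))
      ¬ab ¬ij
      where
      i≢j : skip a i ≢ skip a j
      i≢j = <⇒≢ (skip-mono a i<j)
      j≤ : skip a j ≤ suc m
      j≤ = ≤-trans (skip-≤ a j) j<m
      i≤ : skip a i ≤ suc m
      i≤ = <⇒≤ (<-≤-trans (skip-mono a i<j) j≤)
      only : ∀ {x} → x ≤ suc m → x ≢ a → x ≢ b → ¬ ¬ Adj (v b) (v x)
      only x≤ x≢a x≢b ¬bx with almost b<m (<⇒≤ (<-trans a<b b<m)) x≤ (x≢a ∘ sym) (<⇒≢ a<b) x≢b
      ... | inj₁ ba = ¬ab (symm ba)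
      ... | inj₂ bx = ¬bx bx

    V : Fin (2 + m) → Vertex G
    V i = v (toℕ i)

    V-distinct : ∀ {i j} → V i ≡ V j → i ≡ j
    V-distinct {i} {j} e = Fin.toℕ-injective (distinct (Fin.toℕ≤pred[n] i) (Fin.toℕ≤pred[n] j) e)

    LobeColouring : (Fin (2 + m) → Fin m) → Set
    LobeColouring h = ∀ i j → h i ≡ h j → i ≡ j ⊎ ¬ Adj (V i) (V j)

    -- Starting from `m + 2` distinct colours, each of the two disjoint non-adjacent pairs saves
    -- one.
    colour-lobe : DisjointNonEdges → ∃ LobeColouring
    colour-lobe pairs = g ∘ f , λ i j e → split i j (g-merge (f i) (f j) e)
      where
      open DisjointNonEdges pairs
      at : ∀ {x} → x ≤ suc m → Fin (2 + m)
      at x≤ = fromℕ< (s≤s x≤)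
      at≢ : ∀ {x y} (x≤ : x ≤ suc m) (y≤ : y ≤ suc m) → x ≢ y → at x≤ ≢ at y≤
      at≢ x≤ y≤ x≢y e = x≢y (trans (sym (Fin.toℕ-fromℕ< (s≤s x≤))) (trans (cong toℕ e) (Fin.toℕ-fromℕ< (s≤s y≤))))
      nonadj : ∀ {x y} (x≤ : x ≤ suc m) (y≤ : y ≤ suc m) → ¬ Adj (v x) (v y) → ¬ Adj (V (at x≤)) (V (at y≤))
      nonadj x≤ y≤ ¬xy = ¬xy ∘ subst₂ (λ p q → Adj (v p) (v q)) (Fin.toℕ-fromℕ< (s≤s x≤)) (Fin.toℕ-fromℕ< (s≤s y≤))
      a′ = at a≤
      b′ = at b≤
      c′ = at c≤
      d′ = at d≤
      f = proj₁ (merge a′ b′ (at≢ a≤ b≤ a≢b))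
      f-merge = proj₂ (merge a′ b′ (at≢ a≤ b≤ a≢b))
      -- A position other than `a` and `b` keeps a colour of its own under the first merge.
      unmerged : ∀ {i x} (x≤ : x ≤ suc m) → x ≢ a → x ≢ b → f i ≡ f (at x≤) → i ≡ at x≤
      unmerged {i} x≤ x≢a x≢b e with f-merge i (at x≤) e
      ... | inj₁ eq = eq
      ... | inj₂ (inj₁ (_ , e′)) = contradiction e′ (at≢ x≤ b≤ x≢b)
      ... | inj₂ (inj₂ (_ , e′)) = contradiction e′ (at≢ x≤ a≤ x≢a)
      fc≢fd : f c′ ≢ f d′
      fc≢fd e = at≢ c≤ d≤ c≢d (unmerged {c′} d≤ d≢a d≢b e)
      g = proj₁ (merge (f c′) (f d′) fc≢fd)
      g-merge = proj₂ (merge (f c′) (f d′) fc≢fd)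
      split : ∀ i j → f i ≡ f j ⊎ (f i ≡ f c′ × f j ≡ f d′) ⊎ (f i ≡ f d′ × f j ≡ f c′) →
              i ≡ j ⊎ ¬ Adj (V i) (V j)
      split i j (inj₂ (inj₁ (e , e′))) = inj₂ (subst₂ (λ p q → ¬ Adj (V p) (V q))
        (sym (unmerged {i} c≤ c≢a c≢b e)) (sym (unmerged {j} d≤ d≢a d≢b e′)) (nonadj c≤ d≤ ¬cd))
      split i j (inj₂ (inj₂ (e , e′))) = inj₂ (subst₂ (λ p q → ¬ Adj (V p) (V q))
        (sym (unmerged {i} d≤ d≢a d≢b e)) (sym (unmerged {j} c≤ c≢a c≢b e′)) (nonadj d≤ c≤ (¬cd ∘ symm)))
      split i j (inj₁ e) with f-merge i j e
      ... | inj₁ eq = inj₁ eq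
      ... | inj₂ (inj₁ (refl , refl)) = inj₂ (nonadj a≤ b≤ ¬ab)
      ... | inj₂ (inj₂ (refl , refl)) = inj₂ (nonadj b≤ a≤ (¬ab ∘ symm))

    -- The attaching vertex `v (m + 1)` is not inner, so it stays in `outer`.
    inner? : ∀ y → Dec (∃ λ (i : Fin (suc m)) → v (toℕ i) ≡ y)
    inner? y = Fin.any? λ i → v (toℕ i) Fin.≟ y

    outer? : ∀ y → Dec (¬ ∃ λ (i : Fin (suc m)) → v (toℕ i) ≡ y)
    outer? y = ¬? (inner? y)

    outer : List (Vertex G)
    outer = filter outer? xs

    outer-length : length outer < length xs
    outer-length = filter-notAll outer? xs
      (Any.map (λ { refl ¬inner → ¬inner (zero , refl) }) (member z≤n))

    -- Edges leaving the lobe start at `v (m + 1)`, and `π` permutes the lobe colours so that both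
    -- colourings agree there.
    extend-colouring : ∀ h → LobeColouring h → ColourableOn m outer → ColourableOn m xs
    extend-colouring h h-proper (f , proper) = colour , colour-proper
      where
      last : Fin (2 + m)
      last = fromℕ (suc m)
      π : Fin m → Fin m
      π = transpose (h last) (f (V last))
      located? : ∀ y → Dec (∃ λ i → V i ≡ y)
      located? y = Fin.any? λ i → V i Fin.≟ y
      colour : Vertex G → Fin m
      colour y with located? y
      ... | yes (i , _) = π (h i)
      ... | no _ = f y
      outer-of : ∀ {y} → y ∈ xs → (∀ i → V i ≡ y → i ≡ last) → y ∈ outer
      outer-of y∈ only-last = ∈-filter⁺ outer? y∈ λ (i , eq) →
        <⇒≢ (≤-trans (s≤s (≤-reflexive (Fin.toℕ-inject₁ i))) (Fin.toℕ<n i))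
          (trans (cong toℕ (only-last (inject₁ i) (trans (cong v (Fin.toℕ-inject₁ i)) eq)))
            (Fin.toℕ-fromℕ (suc m)))
      last-outer : V last ∈ outer
      last-outer = outer-of (member (Fin.toℕ≤pred[n] last)) λ i → V-distinct
      boundary : ∀ i {y} → y ∈ xs → ¬ (∃ λ j → V j ≡ y) → Adj (V i) y → π (h i) ≢ f y
      boundary i {y} y∈ off adj with m≤n⇒m<n∨m≡n (Fin.toℕ≤pred[n] i)
      ... | inj₁ i<m with closed i<m y∈ adj
      ...   | j , j≤ , refl = contradiction (fromℕ< (s≤s j≤) , cong v (Fin.toℕ-fromℕ< (s≤s j≤))) off
      boundary i {y} y∈ off adj | inj₂ i≡m
        with Fin.toℕ-injective {j = last} (trans i≡m (sym (Fin.toℕ-fromℕ (suc m))))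
      ... | refl = λ e → proper last-outer (outer-of y∈ λ j eq → contradiction (j , eq) off) adj
        (trans (sym (transpose-matchˡ (h last) (f (V last)))) e)
      colour-proper : ∀ {u w} → u ∈ xs → w ∈ xs → Adj u w → colour u ≢ colour w
      colour-proper {u} {w} u∈ w∈ adj with located? u | located? w
      ... | yes (i , refl) | no off = boundary i w∈ off adj
      ... | no off | yes (j , refl) = boundary j u∈ off (symm adj) ∘ sym
      ... | no off-u | no off-w = proper (outer-of u∈ λ j eq → contradiction (j , eq) off-u)
                                        (outer-of w∈ λ j eq → contradiction (j , eq) off-w) adj
      ... | yes (i , refl) | yes (j , refl) = λ e →
        [ (λ { refl → loopless _ adj }) , (λ ¬adj → ¬adj adj) ]′
          (h-proper i j (transpose-injective (h last) (f (V last)) e))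

    extend-lobe : ColourableOn m outer → ColourableOn m xs
    extend-lobe = let (h , h-proper) = colour-lobe disjoint-non-edges in extend-colouring h h-proper

  -- Strong induction on the number of vertices: delete a vertex of degree at most `2k` or, if there
  -- is none, the inner vertices of a lobe. The double negation stems from `longest-path`.
  colourable-on : ∀ {k} → 3 ≤ k → (∀ u → ¬ SequenceClique (2 + 2 * k) u) →
    (∀ ds → Unique ds → All (λ d → ∃ (IsCycle G (2 * suc d))) ds → length ds ≤ k) →
    ∀ xs → Unique xs → Acc _<_ (length xs) → ¬ ¬ ColourableOn (1 + 2 * k) xs
  colourable-on 3≤k ¬clique bound [] _ _ ¬col = ¬col ((λ _ → zero) , λ ())
  colourable-on {k} 3≤k ¬clique bound xs@(_ ∷ _) xs! (acc smaller) ¬col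
    with Any.any? (λ x → length (filter (adj? x) xs) <? 1 + 2 * k) xs
  ... | yes low with find low
  ...   | x , x∈ , deg< = colourable-on 3≤k ¬clique bound (filter (differs? x) xs)
            (Unique.filter⁺ (differs? x) xs!)
            (smaller (filter-notAll (differs? x) xs (Any.map (λ { refl ≢x → ≢x refl }) x∈)))
            (¬col ∘ extend-low-degree deg<)
  colourable-on {k} 3≤k ¬clique bound xs@(_ ∷ _) xs! (acc smaller) ¬col | no ¬low =
    Walks.longest-path G xs (here refl) λ n v L →
      Minimal.lobe-or-clique G xs xs! k 3≤k bound
        (λ x∈ → ≮⇒≥ λ low → ¬low (lose x∈ low)) n L
        (λ u lobe → let open LobeExtension lobe ¬clique in
          colourable-on 3≤k ¬clique bound outer (Unique.filter⁺ outer? xs!) (smaller outer-length)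
            (¬col ∘ extend-lobe))
        ¬clique

-- From partial colourings to the chromatic number.

unique-length≤cardinality : ∀ {P k} → HasCardinality P k → ∀ ms → Unique ms → All P ms → length ms ≤ k
unique-length≤cardinality (_ , _ , mem , refl) ms ms! Pms =
  unique-⊆⇒length≤ ms! λ {m} m∈ → Equivalence.from (mem m) (All.lookup Pms m∈)

-- Colourability is decidable, hence stable under double negation.
colourable-bound : ∀ G {k} → HasCardinality (Lₑ G) k → 3 ≤ k → ¬ HasClique G (2 + 2 * k) →
  Colourable G (1 + 2 * k)
colourable-bound G {k} card 3≤k ¬clique = decidable-stable (colourable? G (1 + 2 * k)) λ ¬col →
  colourable-on 3≤k (λ u clique → ¬clique (sequenceClique⇒hasClique clique)) bound
    (allFin (order G)) (Unique.allFin⁺ (order G)) (<-wellFounded _)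
    λ (f , proper) → ¬col (f , λ u v → proper (∈-allFin u) (∈-allFin v))
  where
  open Colouring G
  bound : ∀ ds → Unique ds → All (λ d → ∃ (IsCycle G (2 * suc d))) ds → length ds ≤ k
  bound ds ds! cycles = ≤-trans (≤-reflexive (sym (length-map (λ d → 2 * suc d) ds)))
    (unique-length≤cardinality card (map (λ d → 2 * suc d) ds)
      (Unique.map⁺ (λ {a} {b} e → suc-injective (*-cancelˡ-≡ (suc a) (suc b) 2 e)) ds!)
      (All.map⁺ (All.map (λ {d} cycle → m∣m*n (suc d) , cycle) cycles)))

theorem9 : (G : Graph) → Connected G → 3 ≤ ∣Lₑ∣ G → ω G ≤ 2 * ∣Lₑ∣ G + 1 → χ G ≤ 2 * ∣Lₑ∣ G + 1
theorem9 G _ 3≤k ω≤ = ≤-trans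
  (proj₂ (proj₂ (chromaticNumber G)) (1 + 2 * ∣Lₑ∣ G)
    (colourable-bound G (proj₂ (evenCycleLengthCount G)) 3≤k λ clique → 1+n≰n
      (≤-trans (proj₂ (proj₂ (cliqueNumber G)) _ clique) (≤-trans ω≤ (≤-reflexive (+-comm _ 1))))))
  (≤-reflexive (+-comm 1 _))
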